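{- For any parameters $\nu \in (0, 1)$ and $h \in [\log n]$, any weighted path graph $P_n$ on $n$ vertices admits an oblivious $\nu$-reliable $(2h+1)$-hop $1$-spanner with lightness $O\left(h\cdot n^{2/h}\cdot \left(\frac{\log (h/\nu)}{\nu}\right)^2\right)$ and size $O\left(n^{1+1/h}\cdot\frac{\log (h/\nu)}{\nu}\right)$.
   Context: Logarithms are base 2; hidden constants are universal. $h\in[\log n]$ means $h$ is an integer with $1\le h\le\log n$. $P_n$ is the path on vertex set $[n]=\{1,\dots,n\}$ with edges $\{i,i+1\}$ carrying arbitrary positive weights; the metric space is $X=[n]$ with the shortest path metric $d_X$ of $P_n$. Reliable spanners: let $(X,d_X)$ be a finite metric space. For a weighted graph $H$ on vertex set $X$, $d_H$ is its shortest path distance ($\infty$ between different components), $H[Y]$ is the subgraph induced by $Y\subseteq X$, and $H$ is dominating if $d_X(u,v)\le d_H(u,v)$ for all $u,v$. An oblivious $\nu$-reliable $t$-spanner of $(X,d_X)$ is a probability distribution $\mathcal{D}$ over dominating weighted graphs on $X$ such that for every attack set $B\subseteq X$ and every $H\in\mathrm{supp}(\mathcal{D})$ there is a superset $B_H^+\supseteq B$ such that $d_{H[X\setminus B]}(x,y)\le t\cdot d_X(x,y)$ for all $x,y\notin B_H^+$, and $\mathbb{E}_{H\sim\mathcal{D}}[|B_H^+|]\le(1+\nu)|B|$. It is $q$-hop if moreover, for all $x,y\notin B_H^+$, the graph $H[X\setminus B]$ contains an $x$–$y$ path with at most $q$ edges and of weight at most $t\cdot d_X(x,y)$. It has size $m$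 and lightness $\phi$ if every $H\in\mathrm{supp}(\mathcal{D})$ has at most $m$ edges and lightness at most $\phi$, where the lightness of $H$ is $w(H)/w(\mathrm{MST}(X))$, i.e. the total edge weight of $H$ divided by the weight of a minimum spanning tree of $(X,d_X)$ (here, the total weight of $P_n$).
   Formalization: log(h/ν) in both bounds is read as max(1, log(h/ν)), since literally (n=2, h=1, ν→1) they would tend to 0 while an edge is needed; scalars range over any Archimedean ordered field with decidable order (classically including the reals). -}

module Defs where

open import Level using (Level; _⊔_) renaming (suc to lsuc)
open import Algebra.Bundles using (CommutativeRing; Semiring)
open import Data.Bool.Base using (true; false; if_then_else_; _∧_)
open import Data.Bool.Properties using (∧-comm)
open import Data.Fin.Base using (Fin; toℕ)
open import Data.Fin.Properties using (_<?_)
open import Data.Fin.Subset using (Subset; _∉_; _⊆_; ∁; ∣_∣)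
open import Data.Fin.Subset.Properties using (_∈?_)
open import Data.List.Base using (List; length; foldr; mapMaybe; allFin; cartesianProduct)
open import Data.Maybe.Base using (Maybe; just; nothing)
open import Data.Nat.Base as ℕ using (ℕ; suc)
open import Data.Product.Base using (∃; ∃-syntax; _×_; _,_)
open import Data.Sum.Base using (_⊎_)
open import Function.Bundles using (_⇔_)
open import Relation.Binary.Core using (Rel)
open import Relation.Binary.PropositionalEquality.Core using (_≡_; refl; cong₂)
open import Relation.Binary.Structures using (IsDecTotalOrder)
open import Relation.Nullary.Construct.Add.Supremum using (_⁺; [_]; ⊤⁺)
open import Relation.Nullary.Decidable.Core using (does)
open import Relation.Nullary.Negation.Core using (¬_)
import Algebra.Definitions.RawMonoid as RawMonoidOps
import Algebra.Definitions.RawSemiring as RawSemiringOps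
import Relation.Binary.Construct.Add.Supremum.NonStrict as AddSupremum
import Relation.Binary.Construct.NonStrictToStrict as ToStrict

-- The scalars: ℝ with its usual order is, classically, an instance, and every
-- instance embeds in ℝ.

record ArchimedeanOrderedField (c ℓ₁ ℓ₂ : Level) : Set (lsuc (c ⊔ ℓ₁ ⊔ ℓ₂)) where
  infix 4 _≤_
  infix 9 _⁻¹
  infixl 7 _/_
  field
    commutativeRing : CommutativeRing c ℓ₁
  open CommutativeRing commutativeRing public

  field
    _≤_             : Rel Carrier ℓ₂
    isDecTotalOrder : IsDecTotalOrder _≈_ _≤_
    +-monoʳ-≤       : ∀ x {y z} → y ≤ z → x + y ≤ x + z
    *-nonNegative   : ∀ {x y} → 0# ≤ x → 0# ≤ y → 0# ≤ x * y
    1≉0             : ¬ (1# ≈ 0#)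
    -- The value of 0# ⁻¹ is unconstrained.
    _⁻¹             : Carrier → Carrier
    ⁻¹-inverseʳ     : ∀ {x} → ¬ (x ≈ 0#) → x * x ⁻¹ ≈ 1#

  open ToStrict _≈_ _≤_ public using (_<_)
  open RawMonoidOps +-rawMonoid public using (sum)
  open RawSemiringOps (Semiring.rawSemiring semiring) public using (_^_)

  ι : ℕ → Carrier
  ι k = RawMonoidOps._×_ +-rawMonoid k 1#

  _/_ : Carrier → Carrier → Carrier
  x / y = x * y ⁻¹

  field
    archimedean : ∀ x → ∃[ k ] x ≤ ι k

module Spanners {c ℓ₁ ℓ₂} (F : ArchimedeanOrderedField c ℓ₁ ℓ₂) where
  open ArchimedeanOrderedField F hiding (refl)
  open AddSupremum _≤_ public using (_≤⁺_)

  -- Real roots and logarithms need not exist in F, so they enter through their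
  -- upper bounds. Since an Archimedean field is dense in ℝ, x ≤ f (n^{1/h}, log y)
  -- for a continuous monotone f holds iff x ≤ f (ρ , ℓ) for all upper bounds
  -- ρ of n^{1/h} and ℓ of log y in F.

  -- n^{1/h} ≤ ρ
  RootBound : ℕ → ℕ → Carrier → Set ℓ₂
  RootBound n h ρ = 0# ≤ ρ × ι n ≤ ρ ^ h

  -- max (1 , log₂ x) ≤ ℓ, for x ≥ 0: every rational a / b > ℓ has x ≤ 2^{a/b}.
  -- As ℓ ≥ 1, only positive rationals matter.
  LogBound : Carrier → Carrier → Set (ℓ₁ ⊔ ℓ₂)
  LogBound x ℓ = 1# ≤ ℓ × (∀ a b → 1 ℕ.≤ b → ι b * ℓ < ι a → x ^ b ≤ ι 2 ^ a)

  -- Simple graphs: adj u v is the weight of the edge {u , v}, if there is one.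
  record WeightedGraph (n : ℕ) : Set (c ⊔ ℓ₁ ⊔ ℓ₂) where
    field
      adj      : Fin n → Fin n → Maybe Carrier
      adj-sym  : ∀ u v → adj u v ≡ adj v u
      loopless : ∀ u → adj u u ≡ nothing
      positive : ∀ u v {w} → adj u v ≡ just w → 0# < w

  open WeightedGraph public

  edgeWeights : ∀ {n} → WeightedGraph n → List Carrier
  edgeWeights {n} G = mapMaybe edge (cartesianProduct (allFin n) (allFin n))
    where
    edge : Fin n × Fin n → Maybe Carrier
    edge (u , v) = if does (u <? v) then adj G u v else nothing

  size : ∀ {n} → WeightedGraph n → ℕ
  size G = length (edgeWeights G)

  totalWeight : ∀ {n} → WeightedGraph n → Carrier
  totalWeight G = foldr _+_ 0# (edgeWeights G)

  infixr 5 _∷_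
  data Walk {n} (G : WeightedGraph n) : Fin n → Fin n → Set c where
    []  : ∀ {u} → Walk G u u
    _∷_ : ∀ {u v t w} → adj G u v ≡ just w → Walk G v t → Walk G u t

  hops : ∀ {n} {G : WeightedGraph n} {u v} → Walk G u v → ℕ
  hops []      = 0
  hops (_ ∷ p) = suc (hops p)

  weight : ∀ {n} {G : WeightedGraph n} {u v} → Walk G u v → Carrier
  weight []                = 0#
  weight (_∷_ {w = w} _ p) = w + weight p

  -- δ is the shortest path distance d_G(u , v), with ⊤⁺ for ∞. As weights are
  -- positive, walks and paths give the same minimum.
  data IsDistance {n} (G : WeightedGraph n) (u v : Fin n) : Carrier ⁺ → Set (c ⊔ ℓ₁ ⊔ ℓ₂) where
    finite   : ∀ {δ} (p : Walk G u v) → weight p ≈ δ → (∀ (q : Walk G u v) → δ ≤ weight q) →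
               IsDistance G u v [ δ ]
    infinite : ¬ Walk G u v → IsDistance G u v ⊤⁺

  IsShortestPathMetric : ∀ {n} → WeightedGraph n → (Fin n → Fin n → Carrier) → Set (c ⊔ ℓ₁ ⊔ ℓ₂)
  IsShortestPathMetric G d = ∀ u v → IsDistance G u v [ d u v ]

  -- P_n, with vertices numbered from 0.
  IsPathGraph : ∀ {n} → WeightedGraph n → Set c
  IsPathGraph G = ∀ u v → (∃[ w ] adj G u v ≡ just w) ⇔ (toℕ v ≡ suc (toℕ u) ⊎ toℕ u ≡ suc (toℕ v))

  -- The vertices outside Y are kept, but isolated.
  induced : ∀ {n} → WeightedGraph n → Subset n → WeightedGraph n
  induced {n} G Y = record
    { adj      = adj′
    ; adj-sym  = λ u v → cong₂ (λ b e → if b then e else nothing)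
                           (∧-comm (does (u ∈? Y)) (does (v ∈? Y))) (adj-sym G u v)
    ; loopless = loopless′
    ; positive = positive′
    }
    where
    adj′ : Fin n → Fin n → Maybe Carrier
    adj′ u v = if does (u ∈? Y) ∧ does (v ∈? Y) then adj G u v else nothing

    loopless′ : ∀ u → adj′ u u ≡ nothing
    loopless′ u with does (u ∈? Y) ∧ does (u ∈? Y)
    ... | true  = loopless G u
    ... | false = refl

    positive′ : ∀ u v {w} → adj′ u v ≡ just w → 0# < w
    positive′ u v eq with does (u ∈? Y) ∧ does (v ∈? Y)
    positive′ u v eq | true = positive G u v eq

  Dominating : ∀ {n} → (Fin n → Fin n → Carrier) → WeightedGraph n → Set (c ⊔ ℓ₁ ⊔ ℓ₂)
  Dominating d H = ∀ u v → ∃[ δ ] IsDistance H u v δ × [ d u v ] ≤⁺ δ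

  -- A finitely supported distribution; every listed graph is in the support.
  record Distribution (n : ℕ) : Set (c ⊔ ℓ₁ ⊔ ℓ₂) where
    field
      k          : ℕ
      graph      : Fin k → WeightedGraph n
      prob       : Fin k → Carrier
      prob>0     : ∀ i → 0# < prob i
      prob-total : sum prob ≈ 1#

    𝔼 : (Fin k → Carrier) → Carrier
    𝔼 X = sum (λ i → prob i * X i)

  record IsObliviousReliableHopSpanner {n} (d : Fin n → Fin n → Carrier) (ν : Carrier) (q : ℕ)
           (t : Carrier) (D : Distribution n) : Set (c ⊔ ℓ₁ ⊔ ℓ₂) where
    open Distribution D
    field
      dominating : ∀ i → Dominating d (graph i)
      reliable   : ∀ (B : Subset n) → ∃ λ (B⁺ : Fin k → Subset n) →
        (∀ i → B ⊆ B⁺ i) ×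
        (∀ i {x y} → x ∉ B⁺ i → y ∉ B⁺ i →
          (∃ λ δ → IsDistance (induced (graph i) (∁ B)) x y δ × δ ≤⁺ [ t * d x y ]) ×
          (∃ λ (p : Walk (induced (graph i) (∁ B)) x y) → hops p ℕ.≤ q × weight p ≤ t * d x y)) ×
        𝔼 (λ i → ι ∣ B⁺ i ∣) ≤ (1# + ν) * ι ∣ B ∣

  HasSize : ∀ {n} → Distribution n → Carrier → Set ℓ₂
  HasSize D m = ∀ i → ι (size (graph i)) ≤ m
    where open Distribution D

  -- w(H) / w(MST(X)) ≤ φ, multiplied out; mst is w(MST(X)), which for the metric
  -- of a path graph is the total weight of that graph.
  HasLightness : ∀ {n} → Distribution n → (mst φ : Carrier) → Set ℓ₂
  HasLightness D mst φ = ∀ i → totalWeight (graph i) ≤ φ * mst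
    where open Distribution D

{-# OPTIONS --safe #-}
module Submission where

-- The spanner is built from nested samples [n] = N₀ ⊇ N₁ ⊇ ⋯ . With δ = ⌈n^{1/h}⌉,
-- s = O(log(h/ν)/ν) and b_i = s δ^i (b₀ = 1), choose s offsets independently and uniformly
-- below M = s δ^h and let N_i consist of the points congruent to one of them modulo b_i.
-- Two points of N_i closer than b_{i+1} are joined by an edge of weight equal to their
-- distance. Every window of length b_{i+1} holds at most s δ points of N_i, which bounds the
-- size, and, as at most (s δ)² edges of level i cross a given edge of P_n, the lightness.
--
-- Let N = ⌈1/ν⌉ and a = 4N. A point is lost if some window starting or ending at it has
-- more than a/(a+1) of its points in B, or if its window of length b_i meets N_i only in B
-- for some i. By a maximal inequality the former are at most |B| + 2|B|/a. A window of
-- length b holding k ≤ a b/(a+1) points of B is missed by N_i ∖ B with probability at most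
-- (k/b)^s ≤ (k/b) (a/(a+1))^{s-1}; summing k over all windows gives b |B|, so over all
-- levels the latter are at most |B|/a on each side in expectation.
--
-- From a point x that is not lost one climbs monotonically: a point of N_i ∖ B within b_i of x
-- is at level i - 1 either within b_{i-1} of x, or adjacent to a point of N_{i-1} ∖ B that is.
-- Points x < y with b_i ≤ y - x < b_{i+1} climb i levels each and are joined at level i.

open import Defs
open import Algebra.Bundles using (CommutativeSemiring)
open import Data.Bool.Base using (true; false; if_then_else_; _∧_)
import Data.Bool.Properties as Bool
open import Data.Empty using (⊥; ⊥-elim)
open import Data.Fin.Base as Fin using (Fin; toℕ; fromℕ<; zero; suc)
import Data.Fin.Properties as Finₚ
open import Data.Fin.Subset using (Subset; _∈_; _∉_; _⊆_; ∁; ∣_∣)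
open import Data.Fin.Subset.Properties using (_∈?_; x∉p⇒x∈∁p)
open import Data.List.Base as List using (List; []; _∷_; foldr; length; map; mapMaybe; allFin; cartesianProduct)
open import Data.List.Relation.Unary.Any as Any using (Any; here; there; any?)
open import Data.Maybe.Base using (Maybe; just; nothing; maybe′)
open import Data.Maybe.Properties using (just-injective)
open import Data.Nat.Base as ℕ using (ℕ; zero; suc; z<s; s<s; z≤n; s≤s; _⊓_; _⊔_; ∣_-_∣)
open import Data.Nat.Logarithm using (⌊log₂_⌋)
import Data.Nat.Properties as ℕₚ
open import Data.Product.Base using (∃; ∃-syntax; _×_; _,_; proj₁; proj₂)
open import Data.Sum.Base using (_⊎_; inj₁; inj₂)
open import Data.Vec.Base using ([]; _∷_; tabulate; here; there)
open import Data.Vec.Properties using (lookup∘tabulate; lookup⇒[]=)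
open import Function.Base using (_∘_; id; flip)
open import Function.Bundles using (Equivalence)
open import Level using (Level; 0ℓ)
open import Relation.Binary.Bundles using (Poset)
open import Relation.Binary.Core using (Rel)
open import Relation.Binary.Definitions using (tri<; tri≈; tri>)
open import Relation.Binary.PropositionalEquality as ≡ using (_≡_)
open import Relation.Binary.Structures using (IsDecTotalOrder; IsPreorder)
open import Relation.Nullary.Construct.Add.Supremum using ([_])
open import Relation.Nullary.Decidable hiding (map)
open import Relation.Nullary.Negation.Core using (¬_)
open import Relation.Unary using (Pred; Decidable)
import Algebra.Properties.CommutativeSemigroup as CommSemigroup
import Algebra.Properties.Ring as RingProperties
import Algebra.Properties.Semiring.Mult as SemiringMult
import Relation.Binary.Construct.Add.Supremum.NonStrict as AddSupremum
import Relation.Binary.Construct.Flip.EqAndOrd as Flip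
import Relation.Binary.Reasoning.PartialOrder as PosetReasoning

-- Size and lightness must be bounded for every graph in the support, not on average. Congruence
-- classes achieve this: an offset has exactly one point in any window of length b_i, whatever its
-- value. As `M` is a multiple of each b_i with i ≤ h, a uniform offset is uniform modulo b_i, and
-- every probability becomes a count among the M^s outcomes. The obstacle to reliability is that the
-- n windows of a level are too many for a plain union bound: the loss must be a multiple of |B|.
-- Therefore one of the s factors k/b stays untouched, to be summed over the windows, and only the
-- other e = s - 1 are estimated. They are small only away from dense windows, so these are paid for
-- separately, by the maximal inequality. Since (a/(a+1))^a ≤ 1/2, the exponent e = a(m+2) with 2^m
-- ≥ hN brings the e factors down to 1/(4hN), that is 1/(4N) over h levels. With a = 4N, the dense
-- windows and the missed windows cost |B|/(4N) each on either side, together |B|/N ≤ ν|B|.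

-- Finite sums over initial segments of ℕ.

module RangeSum {c ℓ} (R : CommutativeSemiring c ℓ) where

  open CommutativeSemiring R hiding (refl; sym; trans; zero)
  open CommutativeSemiring R using () renaming (refl to ≈-refl; sym to ≈-sym; trans to ≈-trans)

  Σ< : ℕ → (ℕ → Carrier) → Carrier
  Σ< zero    f = 0#
  Σ< (suc n) f = f 0 + Σ< n (f ∘ suc)

  Σ-cong : ∀ n {f g} → (∀ i → i ℕ.< n → f i ≈ g i) → Σ< n f ≈ Σ< n g
  Σ-cong zero    f≈g = ≈-refl
  Σ-cong (suc n) f≈g = +-cong (f≈g 0 z<s) (Σ-cong n λ i i<n → f≈g (suc i) (s<s i<n))

  Σ-zero : ∀ n → Σ< n (λ _ → 0#) ≈ 0#
  Σ-zero zero    = ≈-refl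
  Σ-zero (suc n) = ≈-trans (+-identityˡ _) (Σ-zero n)

  Σ-distrib-+ : ∀ n f g → Σ< n (λ i → f i + g i) ≈ Σ< n f + Σ< n g
  Σ-distrib-+ zero    f g = ≈-sym (+-identityˡ 0#)
  Σ-distrib-+ (suc n) f g = ≈-trans
    (+-congˡ (Σ-distrib-+ n (f ∘ suc) (g ∘ suc))) (interchange _ _ _ _)
    where open CommSemigroup +-commutativeSemigroup using (interchange)

  Σ-comm : ∀ m n (f : ℕ → ℕ → Carrier) → Σ< m (λ i → Σ< n (f i)) ≈ Σ< n (λ j → Σ< m (λ i → f i j))
  Σ-comm zero    n f = ≈-sym (Σ-zero n)
  Σ-comm (suc m) n f = ≈-trans
    (+-congˡ (Σ-comm m n (f ∘ suc)))
    (≈-sym (Σ-distrib-+ n (f 0) _))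

  *-distribˡ-Σ : ∀ n x f → x * Σ< n f ≈ Σ< n (λ i → x * f i)
  *-distribˡ-Σ zero    x f = zeroʳ x
  *-distribˡ-Σ (suc n) x f = ≈-trans
    (distribˡ x _ _) (+-congˡ (*-distribˡ-Σ n x (f ∘ suc)))

  *-distribʳ-Σ : ∀ n x f → Σ< n f * x ≈ Σ< n (λ i → f i * x)
  *-distribʳ-Σ zero    x f = zeroˡ x
  *-distribʳ-Σ (suc n) x f = ≈-trans
    (distribʳ x _ _) (+-congˡ (*-distribʳ-Σ n x (f ∘ suc)))

  -- Sums over the values of a partial function, as they occur in edgeWeights.
  module PartialSum {a} {A : Set a} (w : A → Carrier) where

    total : List A → Carrier
    total = foldr (λ x acc → w x + acc) 0#

    mapMaybe-∷ : ∀ {b} {X : Set b} (f : X → Maybe A) x xs →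
                 total (mapMaybe f (x ∷ xs)) ≈ maybe′ w 0# (f x) + total (mapMaybe f xs)
    mapMaybe-∷ f x xs with f x
    ... | just _  = ≈-refl
    ... | nothing = ≈-sym (+-identityˡ _)

    mapMaybe-++ : ∀ {b} {X : Set b} (f : X → Maybe A) xs ys →
                  total (mapMaybe f (xs List.++ ys)) ≈ total (mapMaybe f xs) + total (mapMaybe f ys)
    mapMaybe-++ f []       ys = ≈-sym (+-identityˡ _)
    mapMaybe-++ f (x ∷ xs) ys = ≈-trans (mapMaybe-∷ f x (xs List.++ ys)) (≈-trans (+-congˡ (mapMaybe-++ f xs ys))
      (≈-trans (≈-sym (+-assoc _ _ _)) (+-congʳ (≈-sym (mapMaybe-∷ f x xs)))))

  -- The relation is a parameter so that the flipped order can be put in as well: the weight of the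
  -- spanner needs upper bounds, the weight of the path a lower one.
  module Ordered {ℓ′} (_≲_ : Rel Carrier ℓ′) (isPreorder : IsPreorder _≈_ _≲_)
    (+-mono : ∀ {x y u v} → x ≲ y → u ≲ v → (x + u) ≲ (y + v)) where

    open IsPreorder isPreorder using (≲-respˡ-≈) renaming (refl to ≲-refl)

    Σ-mono : ∀ n {f g} → (∀ i → i ℕ.< n → f i ≲ g i) → Σ< n f ≲ Σ< n g
    Σ-mono zero    f≲g = ≲-refl
    Σ-mono (suc n) f≲g = +-mono (f≲g 0 z<s) (Σ-mono n λ i i<n → f≲g (suc i) (s<s i<n))

    module _ {a} {A : Set a} (w : A → Carrier) where
      open PartialSum w

      row-≲ : ∀ {b} {X Y : Set b} (f : X → Maybe A) (h : Y → X) m (k : Fin m → Y) {g} →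
              (∀ i → maybe′ w 0# (f (h (k i))) ≲ g (toℕ i)) →
              total (mapMaybe f (map h (List.tabulate k))) ≲ Σ< m g
      row-≲ f h zero    k f≲g = ≲-refl
      row-≲ f h (suc m) k f≲g = ≲-respˡ-≈ (≈-sym (mapMaybe-∷ f (h (k zero)) (map h (List.tabulate (k ∘ suc)))))
        (+-mono (f≲g zero) (row-≲ f h m (k ∘ suc) (f≲g ∘ suc)))

      product-≲ : ∀ {b} {X : Set b} (f : X × X → Maybe A) ys m (k : Fin m → X) {G} →
                  (∀ i → total (mapMaybe f (map (k i ,_) ys)) ≲ G (toℕ i)) →
                  total (mapMaybe f (cartesianProduct (List.tabulate k) ys)) ≲ Σ< m G
      product-≲ f ys zero    k f≲G = ≲-refl
      product-≲ f ys (suc m) k f≲G = ≲-respˡ-≈ (≈-sym (mapMaybe-++ f (map (k zero ,_) ys) (cartesianProduct (List.tabulate (k ∘ suc)) ys)))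
        (+-mono (f≲G zero) (product-≲ f ys m (k ∘ suc) (f≲G ∘ suc)))

      -- With `w = id` the left side is a total weight; with `w` constantly 1 it is the length of
      -- the list. Weight and size are thus treated alike.
      pairs-≲ : ∀ n (f : Fin n × Fin n → Maybe A) {g : ℕ → ℕ → Carrier} →
                (∀ u v → maybe′ w 0# (f (u , v)) ≲ g (toℕ u) (toℕ v)) →
                total (mapMaybe f (cartesianProduct (allFin n) (allFin n))) ≲ Σ< n (λ u → Σ< n (g u))
      pairs-≲ n f f≲g = product-≲ f (allFin n) n id λ u → row-≲ f (u ,_) n id (f≲g u)

-- Sums of natural numbers and counting by indicators.

module Combinatorics where

  open import Data.Nat.Base
  open import Data.Nat.Divisibility using (_∣_; divides; divides-refl; 1∣_; ∣⇒≤)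
  open import Data.Nat.DivMod
  open import Data.Nat.Properties
  open import Data.Nat.Tactic.RingSolver using (solve-∀)
  open ≡ using (refl; sym; trans; cong; cong₂; subst; module ≡-Reasoning)
  open RangeSum +-*-commutativeSemiring
  open Ordered _≤_ ≤-isPreorder +-mono-≤

  Σ-snoc : ∀ n f → Σ< (suc n) f ≡ Σ< n f + f n
  Σ-snoc zero    f = +-comm (f 0) 0
  Σ-snoc (suc n) f = trans (cong (f 0 +_) (Σ-snoc n (f ∘ suc))) (sym (+-assoc (f 0) _ _))

  Σ-split : ∀ m n f → Σ< (m + n) f ≡ Σ< m f + Σ< n (λ j → f (m + j))
  Σ-split zero    n f = refl
  Σ-split (suc m) n f = trans (cong (f 0 +_) (Σ-split m n (f ∘ suc))) (sym (+-assoc (f 0) _ _))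

  Σ-const : ∀ n c → Σ< n (λ _ → c) ≡ n * c
  Σ-const zero    c = refl
  Σ-const (suc n) c = cong (c +_) (Σ-const n c)

  Σ-≤-const : ∀ n {f} c → (∀ i → i < n → f i ≤ c) → Σ< n f ≤ n * c
  Σ-≤-const n c f≤c = ≤-trans (Σ-mono n f≤c) (≤-reflexive (Σ-const n c))

  term≤Σ : ∀ n f {i} → i < n → f i ≤ Σ< n f
  term≤Σ (suc n) f {zero}  _   = m≤m+n (f 0) _
  term≤Σ (suc n) f {suc i} i<n = ≤-trans (term≤Σ n (f ∘ suc) (s<s⁻¹ i<n)) (m≤n+m _ (f 0))

  0<Σ⇒∃ : ∀ n f → 0 < Σ< n f → ∃[ i ] i < n × 0 < f i
  0<Σ⇒∃ (suc n) f 0<Σ with f 0 in eq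
  ... | suc _ = 0 , z<s , subst (0 <_) (sym eq) z<s
  ... | zero  with i , i<n , 0<fi ← 0<Σ⇒∃ n (f ∘ suc) 0<Σ = suc i , s<s i<n , 0<fi

  Σ-blocks : ∀ q m f → Σ< (q * m) f ≡ Σ< q (λ j → Σ< m (λ t → f (j * m + t)))
  Σ-blocks zero    m f = refl
  Σ-blocks (suc q) m f = trans (Σ-split m (q * m) f) (cong (Σ< m f +_)
    (trans (Σ-blocks q m (λ j → f (m + j)))
           (Σ-cong q λ j _ → Σ-cong m λ t _ → cong f (sym (+-assoc m (j * m) t)))))

  -- The doubled tail `2 * f (suc i)` satisfies the same hypothesis with the same `K`, so by
  -- induction it sums to at most `2 * K`; hence the tail is at most `K`, and so is `f 0`.
  Σ-geometric : ∀ n f K → (∀ i → f i * 2 ^ i ≤ K) → Σ< n f ≤ 2 * K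
  Σ-geometric zero    f K bound = z≤n
  Σ-geometric (suc n) f K bound = begin
    f 0 + Σ< n (f ∘ suc)  ≤⟨ +-mono-≤ (≤-trans (≤-reflexive (sym (*-identityʳ (f 0)))) (bound 0)) tail≤K ⟩
    K + K                 ≡⟨ cong (K +_) (+-identityʳ K) ⟨
    2 * K                 ∎
    where
    open ≤-Reasoning
    tail≤K : Σ< n (f ∘ suc) ≤ K
    tail≤K = *-cancelˡ-≤ 2 (begin
      2 * Σ< n (f ∘ suc)            ≡⟨ *-distribˡ-Σ n 2 (f ∘ suc) ⟩
      Σ< n (λ i → 2 * f (suc i))    ≤⟨ Σ-geometric n _ K (λ i → ≤-trans (≤-reflexive
                                         (shuffle (f (suc i)) (2 ^ i))) (bound (suc i))) ⟩
      2 * K                         ∎)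
      where
      shuffle : ∀ x y → 2 * x * y ≡ x * (2 * y)
      shuffle = solve-∀

  private variable
    ℓ₁ ℓ₂ : Level
    P : Set ℓ₁
    Q : Set ℓ₂

  𝟙 : Dec P → ℕ
  𝟙 (yes _) = 1
  𝟙 (no _)  = 0

  𝟙-≤ : (P? : Dec P) {k : ℕ} → (P → 1 ≤ k) → 𝟙 P? ≤ k
  𝟙-≤ (yes p) h = h p
  𝟙-≤ (no _)  h = z≤n

  𝟙≤1 : (P? : Dec P) → 𝟙 P? ≤ 1
  𝟙≤1 P? = 𝟙-≤ P? λ _ → ≤-refl

  𝟙-true : (P? : Dec P) → P → 𝟙 P? ≡ 1
  𝟙-true (yes _) p = refl
  𝟙-true (no ¬p) p = ⊥-elim (¬p p)

  𝟙-false : (P? : Dec P) → ¬ P → 𝟙 P? ≡ 0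
  𝟙-false (yes p) ¬p = ⊥-elim (¬p p)
  𝟙-false (no _)  ¬p = refl

  𝟙-cong : (P? : Dec P) (Q? : Dec Q) → (P → Q) → (Q → P) → 𝟙 P? ≡ 𝟙 Q?
  𝟙-cong P? (yes q) f g = 𝟙-true P? (g q)
  𝟙-cong P? (no ¬q) f g = 𝟙-false P? (¬q ∘ f)

  0<𝟙⇒ : (P? : Dec P) → 0 < 𝟙 P? → P
  0<𝟙⇒ (yes p) _ = p

  Σ-𝟙-≡ : ∀ n {c} → c < n → Σ< n (λ x → 𝟙 (x ≟ c)) ≡ 1
  Σ-𝟙-≡ (suc n) {zero}  _   = cong suc (trans
    (Σ-cong n λ i _ → 𝟙-false (suc i ≟ 0) λ ()) (Σ-zero n))
  Σ-𝟙-≡ (suc n) {suc c} c<n = trans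
    (Σ-cong n λ i _ → 𝟙-cong (suc i ≟ suc c) (i ≟ c) suc-injective (cong suc))
    (Σ-𝟙-≡ n (s<s⁻¹ c<n))

  Σ-𝟙-≡-≤ : ∀ n c → Σ< n (λ x → 𝟙 (x ≟ c)) ≤ 1
  Σ-𝟙-≡-≤ n c with c <? n
  ... | yes c<n = ≤-reflexive (Σ-𝟙-≡ n c<n)
  ... | no  c≮n = ≤-trans (≤-reflexive (trans
          (Σ-cong n λ i i<n → 𝟙-false (i ≟ c) λ { refl → c≮n i<n }) (Σ-zero n))) z≤n

  -- Each index of the right-hand sum serves at most one index of the left-hand sum.
  Σ-reindex : ∀ n L (f g φ : ℕ → ℕ) →
    (∀ x → x < n → 0 < f x → ∃[ j ] j < L × φ j ≡ x × f x ≤ g j) → Σ< n f ≤ Σ< L g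
  Σ-reindex n L f g φ cover = begin
    Σ< n f                                              ≤⟨ Σ-mono n bound ⟩
    Σ< n (λ x → Σ< L (λ j → g j * 𝟙 (x ≟ φ j)))        ≡⟨ Σ-comm n L _ ⟩
    Σ< L (λ j → Σ< n (λ x → g j * 𝟙 (x ≟ φ j)))        ≡⟨ Σ-cong L (λ j _ → *-distribˡ-Σ n (g j) _) ⟨
    Σ< L (λ j → g j * Σ< n (λ x → 𝟙 (x ≟ φ j)))        ≤⟨ Σ-mono L (λ j _ → *-monoʳ-≤ (g j) (Σ-𝟙-≡-≤ n (φ j))) ⟩
    Σ< L (λ j → g j * 1)                                ≡⟨ Σ-cong L (λ j _ → *-identityʳ (g j)) ⟩
    Σ< L g                                              ∎
    where
    open ≤-Reasoning
    bound : ∀ x → x < n → f x ≤ Σ< L (λ j → g j * 𝟙 (x ≟ φ j))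
    bound x x<n with f x in eq
    ... | zero  = z≤n
    ... | suc k with j , j<L , φj≡x , fx≤gj ← cover x x<n (subst (0 <_) (sym eq) z<s) = begin
      suc k                               ≡⟨ eq ⟨
      f x                                 ≤⟨ fx≤gj ⟩
      g j                                 ≡⟨ *-identityʳ (g j) ⟨
      g j * 1                             ≡⟨ cong (g j *_) (𝟙-true (x ≟ φ j) (sym φj≡x)) ⟨
      g j * 𝟙 (x ≟ φ j)                   ≤⟨ term≤Σ L (λ j → g j * 𝟙 (x ≟ φ j)) j<L ⟩
      Σ< L (λ j → g j * 𝟙 (x ≟ φ j))      ∎

  Σ-window : ∀ n a L (f g : ℕ → ℕ) → (∀ x → x < n → 0 < f x → a ≤ x × x < a + L × f x ≤ g x) →
    Σ< n f ≤ Σ< L (λ j → g (a + j))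
  Σ-window n a L f g h = Σ-reindex n L f (λ j → g (a + j)) (a +_) λ x x<n 0<fx →
    let a≤x , x<a+L , fx≤gx = h x x<n 0<fx
        eq = m+[n∸m]≡n a≤x
    in x ∸ a , +-cancelˡ-< a _ _ (subst (_< a + L) (sym eq) x<a+L) , eq ,
       subst (λ y → f x ≤ g y) (sym eq) fx≤gx

  -- Residue classes in windows of consecutive integers.

  module Residues (b : ℕ) .{{_ : NonZero b}} where

    -- Sliding the window by one removes `f a` and adds `f (a + b)`, which equals it.
    Σ-periodic : ∀ (f : ℕ → ℕ) → (∀ x → f (x + b) ≡ f x) → ∀ a → Σ< b (λ j → f (a + j)) ≡ Σ< b f
    Σ-periodic f per zero    = refl
    Σ-periodic f per (suc a) = trans (+-cancelˡ-≡ (f a) _ _ shift) (Σ-periodic f per a)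
      where
      open ≡-Reasoning
      shift : f a + Σ< b (λ j → f (suc a + j)) ≡ f a + Σ< b (λ j → f (a + j))
      shift = begin
        f a + Σ< b (λ j → f (suc a + j))   ≡⟨ cong₂ _+_ (cong f (+-identityʳ a)) (Σ-cong b λ j _ → cong f (+-suc a j)) ⟨
        Σ< (suc b) (λ j → f (a + j))       ≡⟨ Σ-snoc b (λ j → f (a + j)) ⟩
        Σ< b (λ j → f (a + j)) + f (a + b) ≡⟨ cong (Σ< b (λ j → f (a + j)) +_) (per a) ⟩
        Σ< b (λ j → f (a + j)) + f a       ≡⟨ +-comm _ (f a) ⟩
        f a + Σ< b (λ j → f (a + j))       ∎

    Σ-residue : ∀ t a → Σ< b (λ j → 𝟙 ((a + j) % b ≟ t % b)) ≡ 1
    Σ-residue t a = trans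
      (Σ-periodic (λ x → 𝟙 (x % b ≟ t % b)) (λ x → cong (λ y → 𝟙 (y ≟ t % b)) ([m+n]%n≡m%n x b)) a)
      (trans (Σ-cong b λ j j<b → cong (λ y → 𝟙 (y ≟ t % b)) (m<n⇒m%n≡m j<b))
             (Σ-𝟙-≡ b (m%n<n t b)))

    Σ-residue-blocks : ∀ t a q → Σ< (q * b) (λ j → 𝟙 ((a + j) % b ≟ t % b)) ≡ q
    Σ-residue-blocks t a q = begin
      Σ< (q * b) (λ j → 𝟙 ((a + j) % b ≟ t % b))                      ≡⟨ Σ-blocks q b _ ⟩
      Σ< q (λ i → Σ< b (λ j → 𝟙 ((a + (i * b + j)) % b ≟ t % b)))     ≡⟨ Σ-cong q (λ i _ → Σ-cong b λ j _ →
                                                                            cong (λ y → 𝟙 (y % b ≟ t % b)) (+-assoc a (i * b) j)) ⟨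
      Σ< q (λ i → Σ< b (λ j → 𝟙 ((a + i * b + j) % b ≟ t % b)))       ≡⟨ Σ-cong q (λ i _ → Σ-residue t (a + i * b)) ⟩
      Σ< q (λ _ → 1)                                                  ≡⟨ Σ-const q 1 ⟩
      q * 1                                                           ≡⟨ *-identityʳ q ⟩
      q                                                               ∎
      where open ≡-Reasoning

    ∃-residue : ∀ t a → ∃[ j ] j < b × (a + j) % b ≡ t % b
    ∃-residue t a with j , j<b , h ← 0<Σ⇒∃ b _ (subst (0 <_) (sym (Σ-residue t a)) z<s) =
      j , j<b , 0<𝟙⇒ ((a + j) % b ≟ t % b) h

  -- Tuples of independent offsets, encoded as digits.

  module Digits (M : ℕ) .{{_ : NonZero M}} where

    digits : ℕ → ℕ → List ℕ
    digits zero    i = []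
    digits (suc s) i = i % M ∷ digits s (i / M)

    length-digits : ∀ s i → length (digits s i) ≡ s
    length-digits zero    i = refl
    length-digits (suc s) i = cong suc (length-digits s (i / M))

    Π : (ℕ → ℕ) → List ℕ → ℕ
    Π g []       = 1
    Π g (t ∷ ts) = g t * Π g ts

    -- Independence in counting form: as `i` runs below `M ^ s`, its base-`M` digits run through all
    -- `s`-tuples, so the sum of products factors into a product of sums.
    Σ-Π-digits : ∀ (g : ℕ → ℕ) s → Σ< (M ^ s) (λ i → Π g (digits s i)) ≡ Σ< M g ^ s
    Σ-Π-digits g zero    = refl
    Σ-Π-digits g (suc s) = begin
      Σ< (M * M ^ s) (λ i → Π g (digits (suc s) i))             ≡⟨ cong (λ k → Σ< k (λ i → Π g (digits (suc s) i))) (*-comm M (M ^ s)) ⟩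
      Σ< (M ^ s * M) (λ i → Π g (digits (suc s) i))             ≡⟨ Σ-blocks (M ^ s) M _ ⟩
      Σ< (M ^ s) (λ j → Σ< M (λ t → Π g (digits (suc s) (j * M + t))))
                                                                ≡⟨ Σ-cong (M ^ s) (λ j _ → Σ-cong M λ t t<M →
                                                                     cong₂ (λ u v → g u * Π g (digits s v)) (lower j t<M) (upper j t<M)) ⟩
      Σ< (M ^ s) (λ j → Σ< M (λ t → g t * Π g (digits s j)))    ≡⟨ Σ-cong (M ^ s) (λ j _ → *-distribʳ-Σ M (Π g (digits s j)) g) ⟨
      Σ< (M ^ s) (λ j → Σ< M g * Π g (digits s j))              ≡⟨ *-distribˡ-Σ (M ^ s) (Σ< M g) _ ⟨
      Σ< M g * Σ< (M ^ s) (λ j → Π g (digits s j))              ≡⟨ cong (Σ< M g *_) (Σ-Π-digits g s) ⟩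
      Σ< M g * Σ< M g ^ s                                       ∎
      where
      open ≡-Reasoning
      lower : ∀ j {t} → t < M → (j * M + t) % M ≡ t
      lower j {t} t<M = trans (cong (_% M) (+-comm (j * M) t)) (trans ([m+kn]%n≡m%n t j M) (m<n⇒m%n≡m t<M))
      upper : ∀ j {t} → t < M → (j * M + t) / M ≡ j
      upper j {t} t<M = trans (+-distrib-/-∣ˡ t (divides-refl j))
        (trans (cong₂ _+_ (m*n/n≡m j M) (m<n⇒m/n≡0 t<M)) (+-identityʳ j))

  -- The maximal inequality for dense windows.

  module Shadow {B : Pred ℕ 0ℓ} (B? : Decidable B) (a : ℕ) where

    -- Truncated subtraction restarts at score 0 once extending an old window no longer pays, as in
    -- the linear-time search for a maximal subarray.
    step : ∀ {x} → Dec (B x) → ℕ → ℕ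
    step (yes _) k = suc k
    step (no _)  k = k ∸ a

    -- The larger of 0 and the maximal score of a window of positions ending just before x,
    -- where a point of B scores 1 and any other point scores - a.
    scoreˡ : ℕ → ℕ
    scoreˡ zero    = 0
    scoreˡ (suc x) = step (B? x) (scoreˡ x)

    -- The same for the windows of at most m positions starting at x.
    scoreʳ : ℕ → ℕ → ℕ
    scoreʳ zero    x = 0
    scoreʳ (suc m) x = step (B? x) (scoreʳ m (suc x))

    -- The increments `suc a - a = 1` and `0 - a` are those of the two kinds of points; moving `a`
    -- to the other side avoids negative numbers, and truncation only raises the score.
    step-window : ∀ x k → suc a * 𝟙 (B? x) + k ≤ step (B? x) k + a
    step-window x k with B? x
    ... | yes _ = ≤-reflexive (rearrange a k)
      where
      rearrange : ∀ a k → suc a * 1 + k ≡ suc k + a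
      rearrange = solve-∀
    ... | no _  = begin
      suc a * 0 + k   ≡⟨ cong (_+ k) (*-zeroʳ a) ⟩
      k               ≤⟨ m≤n+m∸n k a ⟩
      a + (k ∸ a)     ≡⟨ +-comm a _ ⟩
      k ∸ a + a       ∎
      where open ≤-Reasoning

    shadow? : ∀ x k → Dec (¬ B x × 0 < k)
    shadow? x k = ¬? (B? x) ×-dec (0 <? k)

    -- The score acts as a potential. A point of `B` raises it by 1. A point outside `B` that leaves
    -- it positive has lowered it by exactly `a`, as nothing was truncated, and so is paid for by
    -- `a` units gained at points of `B`.
    step-potential : ∀ x k → a * 𝟙 (shadow? x (step (B? x) k)) + step (B? x) k ≤ 𝟙 (B? x) + k
    step-potential x k with B? x
    ... | yes _ = ≤-reflexive (cong (_+ suc k) (*-zeroʳ a))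
    ... | no ¬p with 0 <? k ∸ a
    ...   | yes 0<k∸a = ≤-reflexive (trans (cong (_+ (k ∸ a)) (*-identityʳ a))
                          (m+[n∸m]≡n (<⇒≤ (m∸n≢0⇒n<m {k} {a} (>⇒≢ 0<k∸a)))))
    ...   | no _ = ≤-trans (≤-reflexive (cong (_+ (k ∸ a)) (*-zeroʳ a))) (m∸n≤m k a)

    -- Its use is at score 0: then no window ending there has more than the fraction `a / (a + 1)`
    -- of its points in `B`.
    windowˡ : ∀ y L → suc a * Σ< L (λ j → 𝟙 (B? (y + j))) ≤ scoreˡ (y + L) + a * L
    windowˡ y zero    = ≤-trans (≤-reflexive (*-zeroʳ a)) z≤n
    windowˡ y (suc L) = begin
      suc a * Σ< (suc L) g                              ≡⟨ cong (suc a *_) (Σ-snoc L g) ⟩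
      suc a * (Σ< L g + g L)                            ≡⟨ *-distribˡ-+ (suc a) (Σ< L g) (g L) ⟩
      suc a * Σ< L g + suc a * g L                      ≤⟨ +-monoˡ-≤ _ (windowˡ y L) ⟩
      scoreˡ (y + L) + a * L + suc a * g L              ≡⟨ rearrange₁ (scoreˡ (y + L)) (a * L) (suc a * g L) ⟩
      suc a * g L + scoreˡ (y + L) + a * L              ≤⟨ +-monoˡ-≤ (a * L) (step-window (y + L) _) ⟩
      scoreˡ (suc (y + L)) + a + a * L                  ≡⟨ rearrange₂ (scoreˡ (suc (y + L))) a L ⟩
      scoreˡ (suc (y + L)) + a * suc L                  ≡⟨ cong (λ z → scoreˡ z + a * suc L) (+-suc y L) ⟨
      scoreˡ (y + suc L) + a * suc L                    ∎
      where
      open ≤-Reasoning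
      g = λ j → 𝟙 (B? (y + j))
      rearrange₁ : ∀ p q r → p + q + r ≡ r + p + q
      rearrange₁ = solve-∀
      rearrange₂ : ∀ p a L → p + a + a * L ≡ p + a * suc L
      rearrange₂ = solve-∀

    windowʳ : ∀ {L m} → L ≤ m → ∀ x → suc a * Σ< L (λ j → 𝟙 (B? (x + j))) ≤ scoreʳ m x + a * L
    windowʳ {zero}  {m}     _   x = ≤-trans (≤-reflexive (*-zeroʳ a)) z≤n
    windowʳ {suc L} {suc m} L≤m x = begin
      suc a * (𝟙 (B? (x + 0)) + Σ< L (λ j → 𝟙 (B? (x + suc j))))
        ≡⟨ cong (suc a *_) (cong₂ _+_ (cong (𝟙 ∘ B?) (+-identityʳ x)) (Σ-cong L λ j _ → cong (𝟙 ∘ B?) (+-suc x j))) ⟩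
      suc a * (𝟙 (B? x) + Σ< L (λ j → 𝟙 (B? (suc x + j))))
        ≡⟨ *-distribˡ-+ (suc a) (𝟙 (B? x)) _ ⟩
      suc a * 𝟙 (B? x) + suc a * Σ< L (λ j → 𝟙 (B? (suc x + j)))
        ≤⟨ +-monoʳ-≤ (suc a * 𝟙 (B? x)) (windowʳ (s≤s⁻¹ L≤m) (suc x)) ⟩
      suc a * 𝟙 (B? x) + (scoreʳ m (suc x) + a * L)
        ≡⟨ +-assoc (suc a * 𝟙 (B? x)) _ _ ⟨
      suc a * 𝟙 (B? x) + scoreʳ m (suc x) + a * L
        ≤⟨ +-monoˡ-≤ (a * L) (step-window x _) ⟩
      scoreʳ (suc m) x + a + a * L
        ≡⟨ rearrange (scoreʳ (suc m) x) a L ⟩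
      scoreʳ (suc m) x + a * suc L ∎
      where
      open ≤-Reasoning
      rearrange : ∀ p a L → p + a + a * L ≡ p + a * suc L
      rearrange = solve-∀

    -- Summing `step-potential` over all positions telescopes; the final score stays on the left so
    -- that the induction goes through.
    shadowˡ-size : ∀ n → a * Σ< n (λ x → 𝟙 (shadow? x (scoreˡ (suc x)))) + scoreˡ n ≤ Σ< n (λ x → 𝟙 (B? x))
    shadowˡ-size zero    = ≤-reflexive (trans (+-identityʳ (a * 0)) (*-zeroʳ a))
    shadowˡ-size (suc n) = begin
      a * Σ< (suc n) g + scoreˡ (suc n)              ≡⟨ cong (λ z → a * z + scoreˡ (suc n)) (Σ-snoc n g) ⟩
      a * (Σ< n g + g n) + scoreˡ (suc n)            ≡⟨ rearrange a (Σ< n g) (g n) (scoreˡ (suc n)) ⟩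
      a * Σ< n g + (a * g n + scoreˡ (suc n))        ≤⟨ +-monoʳ-≤ (a * Σ< n g) (step-potential n (scoreˡ n)) ⟩
      a * Σ< n g + (𝟙 (B? n) + scoreˡ n)             ≡⟨ rearrange′ (a * Σ< n g) (𝟙 (B? n)) (scoreˡ n) ⟩
      a * Σ< n g + scoreˡ n + 𝟙 (B? n)               ≤⟨ +-monoˡ-≤ _ (shadowˡ-size n) ⟩
      Σ< n (λ x → 𝟙 (B? x)) + 𝟙 (B? n)               ≡⟨ Σ-snoc n _ ⟨
      Σ< (suc n) (λ x → 𝟙 (B? x))                    ∎
      where
      open ≤-Reasoning
      g = λ x → 𝟙 (shadow? x (scoreˡ (suc x)))
      rearrange : ∀ a p q r → a * (p + q) + r ≡ a * p + (a * q + r)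
      rearrange = solve-∀
      rearrange′ : ∀ p q r → p + (q + r) ≡ p + r + q
      rearrange′ = solve-∀

    -- The horizon `m ∸ j` shrinks with the position, so all windows end by `x + m`. For `x = 0` and
    -- `m = n` these are the scores that occur in `Lost`.
    shadowʳ-size : ∀ m x → a * Σ< m (λ j → 𝟙 (shadow? (x + j) (scoreʳ (m ∸ j) (x + j)))) + scoreʳ m x ≤
                           Σ< m (λ j → 𝟙 (B? (x + j)))
    shadowʳ-size zero    x = ≤-reflexive (trans (+-identityʳ (a * 0)) (*-zeroʳ a))
    shadowʳ-size (suc m) x = begin
      a * (g x (suc m) + Σ< m (λ j → 𝟙 (shadow? (x + suc j) (scoreʳ (m ∸ j) (x + suc j))))) + scoreʳ (suc m) x
        ≡⟨ cong (λ z → a * z + scoreʳ (suc m) x) (cong₂ _+_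
             (cong (λ y → 𝟙 (shadow? y (scoreʳ (suc m) y))) (+-identityʳ x))
             (Σ-cong m λ j _ → cong (λ y → 𝟙 (shadow? y (scoreʳ (m ∸ j) y))) (+-suc x j))) ⟩
      a * (g′ + Σ′) + scoreʳ (suc m) x               ≡⟨ rearrange a g′ Σ′ (scoreʳ (suc m) x) ⟩
      a * Σ′ + (a * g′ + scoreʳ (suc m) x)           ≤⟨ +-monoʳ-≤ (a * Σ′) (step-potential x (scoreʳ m (suc x))) ⟩
      a * Σ′ + (𝟙 (B? x) + scoreʳ m (suc x))         ≡⟨ rearrange′ (a * Σ′) (𝟙 (B? x)) (scoreʳ m (suc x)) ⟩
      𝟙 (B? x) + (a * Σ′ + scoreʳ m (suc x))         ≤⟨ +-monoʳ-≤ (𝟙 (B? x)) (shadowʳ-size m (suc x)) ⟩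
      𝟙 (B? x) + Σ< m (λ j → 𝟙 (B? (suc x + j)))
        ≡⟨ cong₂ _+_ (cong (𝟙 ∘ B?) (+-identityʳ x)) (Σ-cong m λ j _ → cong (𝟙 ∘ B?) (+-suc x j)) ⟨
      𝟙 (B? (x + 0)) + Σ< m (λ j → 𝟙 (B? (x + suc j))) ∎
      where
      open ≤-Reasoning
      g = λ x m → 𝟙 (shadow? (x + 0) (scoreʳ m (x + 0)))
      g′ = 𝟙 (shadow? x (scoreʳ (suc m) x))
      Σ′ = Σ< m (λ j → 𝟙 (shadow? (suc x + j) (scoreʳ (m ∸ j) (suc x + j))))
      rearrange : ∀ a p q r → a * (p + q) + r ≡ a * q + (a * p + r)
      rearrange = solve-∀
      rearrange′ : ∀ p q r → p + (q + r) ≡ q + (p + r)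
      rearrange′ = solve-∀

  -- The nested samples and the edges of the spanner.

  module Sampling (n h e δ : ℕ) .{{δ≢0 : NonZero δ}} where

    s : ℕ
    s = suc e

    -- Modulus 1 at the bottom puts every point into level 0, and a window of length 1 pins down its
    -- point. Above, the factor `s` cancels against the `s` offsets, leaving density at most
    -- `1 / δ ^ i`.
    block : ℕ → ℕ
    block zero    = 1
    block (suc i) = s * δ ^ suc i

    block≢0 : ∀ i → NonZero (block i)
    block≢0 zero    = _
    block≢0 (suc i) = m*n≢0 s (δ ^ suc i) {{_}} {{m^n≢0 δ (suc i)}}

    residue : ℕ → ℕ → ℕ
    residue i x = _%_ x (block i) {{block≢0 i}}

    block-suc : ∀ i → block (suc (suc i)) ≡ δ * block (suc i)
    block-suc i = rearrange s δ (δ ^ suc i)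
      where
      rearrange : ∀ s d x → s * (d * x) ≡ d * (s * x)
      rearrange = solve-∀

    block-∣ : ∀ i → block i ∣ block (suc i)
    block-∣ zero    = 1∣ _
    block-∣ (suc i) = divides δ (block-suc i)

    block-≤-suc : ∀ i → block i ≤ block (suc i)
    block-≤-suc i = ∣⇒≤ {{block≢0 (suc i)}} (block-∣ i)

    δ^≤block : ∀ i → δ ^ i ≤ block i
    δ^≤block zero    = ≤-refl
    δ^≤block (suc i) = m≤m+n (δ ^ suc i) _

    -- A multiple of `block i` for every `i ≤ h`, so that a uniform offset below `M` is uniform
    -- modulo each of them.
    M : ℕ
    M = s * δ ^ h

    M≢0 : NonZero M
    M≢0 = m*n≢0 s (δ ^ h) {{_}} {{m^n≢0 δ h}}

    -- The outcomes 0 , … , M ^ s - 1 encode s independent uniform offsets below M.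
    sample : ℕ → List ℕ
    sample = Digits.digits M {{M≢0}} s

    infix 4 _∈N[_]_

    _∈N[_]_ : ℕ → ℕ → List ℕ → Set
    x ∈N[ i ] ts = Any (λ t → residue i x ≡ residue i t) ts

    N? : ∀ i ts x → Dec (x ∈N[ i ] ts)
    N? i ts x = any? (λ t → residue i x ≟ residue i t) ts

    N₀-all : ∀ x t ts → x ∈N[ 0 ] (t ∷ ts)
    N₀-all x t ts = here (trans (n%1≡0 x) (sym (n%1≡0 t)))

    N-nested : ∀ {x ts} i → x ∈N[ suc i ] ts → x ∈N[ i ] ts
    N-nested {x} i = Any.map λ {t} eq → trans (sym (coarsen x)) (trans (cong (residue i) eq) (coarsen t))
      where
      coarsen : ∀ y → residue i (residue (suc i) y) ≡ residue i y
      coarsen y = m∣n⇒o%n%m≡o%m (block i) (block (suc i)) y {{block≢0 i}} {{block≢0 (suc i)}} (block-∣ i)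

    -- One offset contributes exactly one point to each of the `q` blocks; coincidences between
    -- offsets only lower the count.
    N-count : ∀ i q ts a → Σ< (q * block i) (λ j → 𝟙 (N? i ts (a + j))) ≤ length ts * q
    N-count i q []       a = ≤-reflexive (Σ-zero (q * block i))
    N-count i q (t ∷ ts) a = begin
      Σ< L (λ j → 𝟙 (N? i (t ∷ ts) (a + j)))
        ≤⟨ Σ-mono L (λ j _ → 𝟙-≤ (N? i (t ∷ ts) (a + j)) (union j)) ⟩
      Σ< L (λ j → 𝟙 (residue i (a + j) ≟ residue i t) + 𝟙 (N? i ts (a + j)))
        ≡⟨ Σ-distrib-+ L _ _ ⟩
      Σ< L (λ j → 𝟙 (residue i (a + j) ≟ residue i t)) + Σ< L (λ j → 𝟙 (N? i ts (a + j)))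
        ≤⟨ +-mono-≤ (≤-reflexive (Σ-residue-blocks t a q)) (N-count i q ts a) ⟩
      q + length ts * q ∎
      where
      open ≤-Reasoning
      open Residues (block i) {{block≢0 i}}
      L = q * block i
      union : ∀ j → (a + j) ∈N[ i ] (t ∷ ts) →
              1 ≤ 𝟙 (residue i (a + j) ≟ residue i t) + 𝟙 (N? i ts (a + j))
      union j (here eq) = m≤n⇒m≤n+o _ (≤-reflexive (sym (𝟙-true (_ ≟ _) eq)))
      union j (there p) = m≤n⇒m≤o+n _ (≤-reflexive (sym (𝟙-true (N? i ts (a + j)) p)))

    module Offsets (ts : List ℕ) (|ts|≡s : length ts ≡ s) where

      -- At level 0 the window has only `s * δ` positions; above, it consists of `δ` blocks with one
      -- point per offset each. This holds for every outcome, not just on average.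
      N-local : ∀ i a → Σ< (block (suc i)) (λ j → 𝟙 (N? i ts (a + j))) ≤ s * δ
      N-local zero    a = begin
        Σ< (block 1) (λ j → 𝟙 (N? 0 ts (a + j)))   ≤⟨ Σ-≤-const (block 1) 1 (λ j _ → 𝟙≤1 (N? 0 ts (a + j))) ⟩
        block 1 * 1                                ≡⟨ trans (*-identityʳ (block 1)) (cong (s *_) (*-identityʳ δ)) ⟩
        s * δ                                      ∎
        where open ≤-Reasoning
      N-local (suc i) a = begin
        Σ< (block (suc (suc i))) (λ j → 𝟙 (N? (suc i) ts (a + j)))
          ≡⟨ cong (λ L → Σ< L (λ j → 𝟙 (N? (suc i) ts (a + j)))) (block-suc i) ⟩
        Σ< (δ * block (suc i)) (λ j → 𝟙 (N? (suc i) ts (a + j)))   ≤⟨ N-count (suc i) δ ts a ⟩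
        length ts * δ                                              ≡⟨ cong (_* δ) |ts|≡s ⟩
        s * δ                                                      ∎
        where open ≤-Reasoning

      -- Rounding `n` up to whole blocks adds at most one block, which `block i ≤ n` absorbs into
      -- the factor 2.
      N-size : ∀ i → block i ≤ n → Σ< n (λ x → 𝟙 (N? i ts x)) * δ ^ i ≤ 2 * n
      N-size zero    _   = begin
        Σ< n (λ x → 𝟙 (N? 0 ts x)) * 1   ≡⟨ *-identityʳ _ ⟩
        Σ< n (λ x → 𝟙 (N? 0 ts x))       ≤⟨ Σ-≤-const n 1 (λ x _ → 𝟙≤1 (N? 0 ts x)) ⟩
        n * 1                            ≡⟨ *-identityʳ n ⟩
        n                                ≤⟨ m≤m+n n _ ⟩
        2 * n                            ∎
        where open ≤-Reasoning
      N-size (suc i) b≤n = begin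
        Σ< n (λ x → 𝟙 (N? (suc i) ts x)) * D
          ≤⟨ *-monoˡ-≤ D (Σ-window n 0 (q * b) _ (λ x → 𝟙 (N? (suc i) ts x)) inside) ⟩
        Σ< (q * b) (λ x → 𝟙 (N? (suc i) ts x)) * D
          ≤⟨ *-monoˡ-≤ D (N-count (suc i) q ts 0) ⟩
        length ts * q * D     ≡⟨ cong (λ l → l * q * D) |ts|≡s ⟩
        s * q * D             ≡⟨ rearrange s q D ⟩
        b + n/b * b           ≤⟨ +-mono-≤ b≤n (m/n*n≤m n b {{block≢0 (suc i)}}) ⟩
        n + n                 ≡⟨ cong (n +_) (+-identityʳ n) ⟨
        2 * n                 ∎
        where
        open ≤-Reasoning
        b = block (suc i)
        n/b = _/_ n b {{block≢0 (suc i)}}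
        q = suc n/b
        D = δ ^ suc i
        rearrange : ∀ s q D → s * q * D ≡ q * (s * D)
        rearrange = solve-∀
        instance _ = block≢0 (suc i)
        n<q*b : n < q * b
        n<q*b = begin-strict
          n                     ≡⟨ m≡m%n+[m/n]*n n b ⟩
          n % b + n / b * b     <⟨ +-monoˡ-< (n / b * b) (m%n<n n b) ⟩
          b + n / b * b         ∎
        inside : ∀ x → x < n → 0 < 𝟙 (N? (suc i) ts x) →
                 0 ≤ x × x < q * b × 𝟙 (N? (suc i) ts x) ≤ 𝟙 (N? (suc i) ts x)
        inside x x<n _ = z≤n , <-trans x<n n<q*b , ≤-refl

    -- `block≤n` keeps out the levels whose block is longer than the path, where the rounding in
    -- `N-size` could not be absorbed.
    record EdgeAt (ts : List ℕ) (u v i : ℕ) : Set where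
      constructor edgeAt
      field
        block≤n : block i ≤ n
        source  : u ∈N[ i ] ts
        target  : v ∈N[ i ] ts
        close   : v < u + block (suc i)

    Edge : List ℕ → ℕ → ℕ → Set
    Edge ts u v = u < v × ∃[ i ] i < h × EdgeAt ts u v i

    edgeAt? : ∀ ts u v i → Dec (EdgeAt ts u v i)
    edgeAt? ts u v i = map′ (λ (a , b , c , d) → edgeAt a b c d) (λ (edgeAt a b c d) → a , b , c , d)
      (block i ≤? n ×-dec N? i ts u ×-dec N? i ts v ×-dec v <? u + block (suc i))

    opaque
      edge? : ∀ ts u v → Dec (Edge ts u v)
      edge? ts u v = u <? v ×-dec anyUpTo? (edgeAt? ts u v) h

    -- Counting the edges, in total and across one gap of the path.

    module EdgeCount (ts : List ℕ) (|ts|≡s : length ts ≡ s) where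
      open Offsets ts |ts|≡s
      open EdgeAt

      -- Level `i` has at most `2 * n / δ ^ i` left ends, so these add up geometrically to `4 * n`
      -- and no factor `h` arises; each has at most `s * δ` right ends.
      edge-count : 2 ≤ δ → Σ< n (λ u → Σ< n (λ v → 𝟙 (edge? ts u v))) ≤ 4 * n * (s * δ)
      edge-count 2≤δ = begin
        Σ< n (λ u → Σ< n (λ v → 𝟙 (edge? ts u v)))
          ≤⟨ Σ-mono n (λ u _ → Σ-mono n λ v _ → 𝟙-≤ (edge? ts u v) (at-level u v)) ⟩
        Σ< n (λ u → Σ< n (λ v → Σ< h (λ i → 𝟙 (src? i u) * 𝟙 (tgt? i u v))))
          ≡⟨ Σ-cong n (λ u _ → Σ-comm n h (λ v i → 𝟙 (src? i u) * 𝟙 (tgt? i u v))) ⟩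
        Σ< n (λ u → Σ< h (λ i → Σ< n (λ v → 𝟙 (src? i u) * 𝟙 (tgt? i u v))))
          ≡⟨ Σ-cong n (λ u _ → Σ-cong h λ i _ → *-distribˡ-Σ n (𝟙 (src? i u)) _) ⟨
        Σ< n (λ u → Σ< h (λ i → 𝟙 (src? i u) * Σ< n (λ v → 𝟙 (tgt? i u v))))
          ≤⟨ Σ-mono n (λ u _ → Σ-mono h λ i _ → *-monoʳ-≤ (𝟙 (src? i u)) (targets i u)) ⟩
        Σ< n (λ u → Σ< h (λ i → 𝟙 (src? i u) * (s * δ)))
          ≡⟨ Σ-comm n h _ ⟩
        Σ< h (λ i → Σ< n (λ u → 𝟙 (src? i u) * (s * δ)))
          ≡⟨ Σ-cong h (λ i _ → *-distribʳ-Σ n (s * δ) (λ u → 𝟙 (src? i u))) ⟨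
        Σ< h (λ i → Σ< n (λ u → 𝟙 (src? i u)) * (s * δ))
          ≡⟨ *-distribʳ-Σ h (s * δ) _ ⟨
        Σ< h (λ i → Σ< n (λ u → 𝟙 (src? i u))) * (s * δ)
          ≤⟨ *-monoˡ-≤ (s * δ) (Σ-geometric h _ (2 * n) sources) ⟩
        2 * (2 * n) * (s * δ)
          ≡⟨ cong (_* (s * δ)) (*-assoc 2 2 n) ⟨
        4 * n * (s * δ) ∎
        where
        open ≤-Reasoning
        src? : ∀ i u → Dec (block i ≤ n × u ∈N[ i ] ts)
        src? i u = block i ≤? n ×-dec N? i ts u
        tgt? : ∀ i u v → Dec (v ∈N[ i ] ts × u ≤ v × v < u + block (suc i))
        tgt? i u v = N? i ts v ×-dec u ≤? v ×-dec v <? u + block (suc i)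
        at-level : ∀ u v → Edge ts u v → 1 ≤ Σ< h (λ i → 𝟙 (src? i u) * 𝟙 (tgt? i u v))
        at-level u v (u<v , i , i<h , E) = ≤-trans
          (≤-reflexive (sym (cong₂ _*_ (𝟙-true (src? i u) (block≤n E , source E))
                                       (𝟙-true (tgt? i u v) (target E , <⇒≤ u<v , close E)))))
          (term≤Σ h (λ i → 𝟙 (src? i u) * 𝟙 (tgt? i u v)) i<h)
        targets : ∀ i u → Σ< n (λ v → 𝟙 (tgt? i u v)) ≤ s * δ
        targets i u = ≤-trans
          (Σ-window n u (block (suc i)) _ (λ v → 𝟙 (N? i ts v)) λ v _ 0<𝟙 →
            let v∈N , u≤v , v<u+b = 0<𝟙⇒ (tgt? i u v) 0<𝟙
            in u≤v , v<u+b , 𝟙-≤ (tgt? i u v) λ _ → ≤-reflexive (sym (𝟙-true (N? i ts v) v∈N)))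
          (N-local i u)
        sources′ : ∀ i (b≤n? : Dec (block i ≤ n)) → Σ< n (λ u → 𝟙 (b≤n? ×-dec N? i ts u)) * 2 ^ i ≤ 2 * n
        sources′ i (no _)    = ≤-trans (≤-reflexive (cong (_* 2 ^ i) (Σ-zero n))) z≤n
        sources′ i (yes b≤n) = begin
          Σ< n (λ u → 𝟙 (yes b≤n ×-dec N? i ts u)) * 2 ^ i   ≤⟨ *-mono-≤ (Σ-mono n λ u _ → 𝟙-≤ (yes b≤n ×-dec N? i ts u)
                                                                  λ (_ , u∈N) → ≤-reflexive (sym (𝟙-true (N? i ts u) u∈N)))
                                                                (^-monoˡ-≤ i 2≤δ) ⟩
          Σ< n (λ u → 𝟙 (N? i ts u)) * δ ^ i                 ≤⟨ N-size i b≤n ⟩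
          2 * n                                              ∎
        sources : ∀ i → Σ< n (λ u → 𝟙 (src? i u)) * 2 ^ i ≤ 2 * n
        sources i = sources′ i (block i ≤? n)

      -- An edge of level `i` over the gap after `x` has its ends in two windows of length
      -- `block (suc i)` around `x`, and `N-local` bounds both. These counts do not decay with `i`,
      -- whence the factor `h`.
      crossing-count : ∀ x → Σ< n (λ u → Σ< n (λ v → 𝟙 (edge? ts u v ×-dec (u ≤? x ×-dec x <? v)))) ≤
                             h * ((s * δ) * (s * δ))
      crossing-count x = begin
        Σ< n (λ u → Σ< n (λ v → 𝟙 (crossing? u v)))
          ≤⟨ Σ-mono n (λ u _ → Σ-mono n λ v _ → 𝟙-≤ (crossing? u v) (at-level u v)) ⟩
        Σ< n (λ u → Σ< n (λ v → Σ< h (λ i → 𝟙 (src? i u) * 𝟙 (tgt? i v))))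
          ≡⟨ Σ-cong n (λ u _ → Σ-comm n h (λ v i → 𝟙 (src? i u) * 𝟙 (tgt? i v))) ⟩
        Σ< n (λ u → Σ< h (λ i → Σ< n (λ v → 𝟙 (src? i u) * 𝟙 (tgt? i v))))
          ≡⟨ Σ-cong n (λ u _ → Σ-cong h λ i _ → *-distribˡ-Σ n (𝟙 (src? i u)) _) ⟨
        Σ< n (λ u → Σ< h (λ i → 𝟙 (src? i u) * Σ< n (λ v → 𝟙 (tgt? i v))))
          ≡⟨ Σ-comm n h _ ⟩
        Σ< h (λ i → Σ< n (λ u → 𝟙 (src? i u) * Σ< n (λ v → 𝟙 (tgt? i v))))
          ≡⟨ Σ-cong h (λ i _ → *-distribʳ-Σ n _ (λ u → 𝟙 (src? i u))) ⟨
        Σ< h (λ i → Σ< n (λ u → 𝟙 (src? i u)) * Σ< n (λ v → 𝟙 (tgt? i v)))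
          ≤⟨ Σ-≤-const h _ (λ i _ → *-mono-≤ (sources i) (targets i)) ⟩
        h * ((s * δ) * (s * δ)) ∎
        where
        open ≤-Reasoning
        crossing? : ∀ u v → Dec (Edge ts u v × u ≤ x × x < v)
        crossing? u v = edge? ts u v ×-dec (u ≤? x ×-dec x <? v)
        src? : ∀ i u → Dec (u ∈N[ i ] ts × u ≤ x × x < u + block (suc i))
        src? i u = N? i ts u ×-dec u ≤? x ×-dec x <? u + block (suc i)
        tgt? : ∀ i v → Dec (v ∈N[ i ] ts × x ≤ v × v < x + block (suc i))
        tgt? i v = N? i ts v ×-dec x ≤? v ×-dec v <? x + block (suc i)
        at-level : ∀ u v → Edge ts u v × u ≤ x × x < v → 1 ≤ Σ< h (λ i → 𝟙 (src? i u) * 𝟙 (tgt? i v))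
        at-level u v ((u<v , i , i<h , E) , u≤x , x<v) = ≤-trans
          (≤-reflexive (sym (cong₂ _*_
            (𝟙-true (src? i u) (source E , u≤x , <-trans x<v (close E)))
            (𝟙-true (tgt? i v) (target E , <⇒≤ x<v , <-≤-trans (close E) (+-monoˡ-≤ (block (suc i)) u≤x))))))
          (term≤Σ h (λ i → 𝟙 (src? i u) * 𝟙 (tgt? i v)) i<h)
        targets : ∀ i → Σ< n (λ v → 𝟙 (tgt? i v)) ≤ s * δ
        targets i = ≤-trans
          (Σ-window n x (block (suc i)) _ (λ v → 𝟙 (N? i ts v)) λ v _ 0<𝟙 →
            let v∈N , x≤v , v<x+b = 0<𝟙⇒ (tgt? i v) 0<𝟙
            in x≤v , v<x+b , 𝟙-≤ (tgt? i v) λ _ → ≤-reflexive (sym (𝟙-true (N? i ts v) v∈N)))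
          (N-local i x)
        sources : ∀ i → Σ< n (λ u → 𝟙 (src? i u)) ≤ s * δ
        sources i = ≤-trans
          (Σ-window n left b _ (λ u → 𝟙 (N? i ts u)) λ u _ 0<𝟙 →
            let u∈N , u≤x , x<u+b = 0<𝟙⇒ (src? i u) 0<𝟙
            in m≤n+o⇒m∸n≤o (suc x) b (≤-trans x<u+b (≤-reflexive (+-comm u b))) ,
               <-≤-trans (s≤s u≤x) (≤-trans (m≤n+m∸n (suc x) b) (≤-reflexive (+-comm b left))) ,
               𝟙-≤ (src? i u) λ _ → ≤-reflexive (sym (𝟙-true (N? i ts u) u∈N)))
          (N-local i left)
          where
          b     = block (suc i)
          -- Near the beginning of the path the subtraction truncates and the window reaches beyond
          -- `x`, which is harmless for an upper bound.
          left = suc x ∸ b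

  -- How many offsets suffice.

  ^-distribʳ-* : ∀ k x y → (x * y) ^ k ≡ x ^ k * y ^ k
  ^-distribʳ-* zero    x y = refl
  ^-distribʳ-* (suc k) x y = trans (cong (x * y *_) (^-distribʳ-* k x y)) (interchange x y (x ^ k) (y ^ k))
    where
    interchange : ∀ a b c d → a * b * (c * d) ≡ a * c * (b * d)
    interchange = solve-∀

  -- `1 + k / a ≤ (1 + 1 / a) ^ k`, cleared of denominators.
  bernoulli : ∀ a k → (a + k) * a ^ k ≤ a * suc a ^ k
  bernoulli a zero    = ≤-reflexive (cong (_* 1) (+-identityʳ a))
  bernoulli a (suc k) = begin
    (a + suc k) * (a * a ^ k)         ≤⟨ m≤m+n _ (k * a ^ k) ⟩
    (a + suc k) * (a * a ^ k) + k * a ^ k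
                                      ≡⟨ rearrange₁ a k (a ^ k) ⟩
    suc a * ((a + k) * a ^ k)         ≤⟨ *-monoʳ-≤ (suc a) (bernoulli a k) ⟩
    suc a * (a * suc a ^ k)           ≡⟨ rearrange₂ (suc a) a (suc a ^ k) ⟩
    a * (suc a * suc a ^ k)           ∎
    where
    open ≤-Reasoning
    rearrange₁ : ∀ a k x → (a + suc k) * (a * x) + k * x ≡ suc a * ((a + k) * x)
    rearrange₁ = solve-∀
    rearrange₂ : ∀ x a y → x * (a * y) ≡ a * (x * y)
    rearrange₂ = solve-∀

  -- Bernoulli's inequality with exponent `a` gives `(a / (a + 1)) ^ a ≤ 1 / 2`; the rest is its
  -- `k`-th power.
  halving : ∀ a .{{_ : NonZero a}} k → 2 ^ k * a ^ (a * k) ≤ suc a ^ (a * k)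
  halving a k = begin
    2 ^ k * a ^ (a * k)       ≡⟨ cong (2 ^ k *_) (^-*-assoc a a k) ⟨
    2 ^ k * (a ^ a) ^ k       ≡⟨ ^-distribʳ-* k 2 (a ^ a) ⟨
    (2 * a ^ a) ^ k           ≤⟨ ^-monoˡ-≤ k (*-cancelˡ-≤ a (begin
      a * (2 * a ^ a)           ≡⟨ rearrange a (a ^ a) ⟩
      (a + a) * a ^ a           ≤⟨ bernoulli a a ⟩
      a * suc a ^ a             ∎)) ⟩
    (suc a ^ a) ^ k           ≡⟨ ^-*-assoc (suc a) a k ⟩
    suc a ^ (a * k)           ∎
    where
    open ≤-Reasoning
    rearrange : ∀ a x → a * (2 * x) ≡ (a + a) * x
    rearrange = solve-∀

  -- The `+ 2` in the exponent pays for the factor 4, by which each of the four kinds of loss gets a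
  -- quarter of the budget `|B| / N`.
  repetitions-suffice : ∀ h N m .{{_ : NonZero N}} → h * N ≤ 2 ^ m →
    let a = 4 * N; e = a * (m + 2) in 4 * h * N * a ^ e ≤ suc a ^ e
  repetitions-suffice h N m hN≤2^m = begin
    4 * h * N * a ^ e         ≤⟨ *-monoˡ-≤ (a ^ e) (begin
      4 * h * N                 ≡⟨ *-assoc 4 h N ⟩
      4 * (h * N)               ≤⟨ *-monoʳ-≤ 4 hN≤2^m ⟩
      4 * 2 ^ m                 ≡⟨ *-comm 4 (2 ^ m) ⟩
      2 ^ m * 2 ^ 2             ≡⟨ ^-distribˡ-+-* 2 m 2 ⟨
      2 ^ (m + 2)               ∎) ⟩
    2 ^ (m + 2) * a ^ e       ≤⟨ halving a {{m*n≢0 4 N}} (m + 2) ⟩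
    suc a ^ e                 ∎
    where
    open ≤-Reasoning
    a = 4 * N
    e = a * (m + 2)

  -- Chains indexed by their number of steps, the later hop count.

  infixr 5 _∷_ _++_

  data Chain (_⟶_ : ℕ → ℕ → Set) : ℕ → ℕ → ℕ → Set where
    []  : ∀ {x} → Chain _⟶_ 0 x x
    _∷_ : ∀ {k x y z} → x ⟶ y → Chain _⟶_ k y z → Chain _⟶_ (suc k) x z

  _++_ : ∀ {_⟶_ k l x y z} → Chain _⟶_ k x y → Chain _⟶_ l y z → Chain _⟶_ (k + l) x z
  []      ++ d = d
  (e ∷ c) ++ d = e ∷ (c ++ d)

  straight : ∀ {_⟶_} {x y} → (∀ z → x ≤ z → z < y → z ⟶ suc z) → x ≤ y → ∃[ k ] Chain _⟶_ k x y
  straight {_⟶_} step x≤y = go step (≤⇒≤′ x≤y)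
    where
    go : ∀ {x y} → (∀ z → x ≤ z → z < y → z ⟶ suc z) → x ≤′ y → ∃[ k ] Chain _⟶_ k x y
    go step ≤′-refl = 0 , []
    go step (≤′-step x≤y) with k , c ← go (λ z x≤z z<y → step z x≤z (m<n⇒m<1+n z<y)) x≤y =
      k + 1 , c ++ step _ (≤′⇒≤ x≤y) ≤-refl ∷ []

  -- The points lost to an attack.

  module Attack (n h e δ N : ℕ) .{{δ≢0 : NonZero δ}}
    {B : Pred ℕ 0ℓ} (B? : Decidable B) (B⊆[n] : ∀ {x} → B x → x < n) where

    open Sampling n h e δ

    a |B| : ℕ
    a   = 4 * N
    |B| = Σ< n (λ x → 𝟙 (B? x))

    open Shadow B? a
    open Digits M {{M≢0}} using (Π; Σ-Π-digits)

    block∣M : ∀ {i} → i ≤ h → ∃[ q ] M ≡ q * block i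
    block∣M {zero}  _   = M , sym (*-identityʳ M)
    block∣M {suc i} i<h = δ ^ (h ∸ suc i) , (begin
      s * δ ^ h                               ≡⟨ cong (λ k → s * δ ^ k) (m∸n+n≡m i<h) ⟨
      s * δ ^ (h ∸ suc i + suc i)             ≡⟨ cong (s *_) (^-distribˡ-+-* δ (h ∸ suc i) (suc i)) ⟩
      s * (δ ^ (h ∸ suc i) * δ ^ suc i)       ≡⟨ rearrange s (δ ^ (h ∸ suc i)) (δ ^ suc i) ⟩
      δ ^ (h ∸ suc i) * (s * δ ^ suc i)       ∎)
      where
      open ≡-Reasoning
      rearrange : ∀ s x y → s * (x * y) ≡ x * (s * y)
      rearrange = solve-∀

    Hit : List ℕ → ℕ → ℕ → Set
    Hit ts i y = ∃[ j ] j < block i × (y + j) ∈N[ i ] ts × ¬ B (y + j)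

    hit? : ∀ ts i y → Dec (Hit ts i y)
    hit? ts i y = anyUpTo? (λ j → N? i ts (y + j) ×-dec ¬? (B? (y + j))) (block i)

    load : ℕ → ℕ → ℕ
    load i y = Σ< (block i) (λ j → 𝟙 (B? (y + j)))

    Sparse : ℕ → ℕ → Set
    Sparse i y = suc a * load i y ≤ a * block i

    -- Dense windows are left to the shadows; sparsity is what makes a miss unlikely.
    Killed : List ℕ → ℕ → ℕ → Set
    Killed ts i y = Sparse i y × ¬ Hit ts i y

    killed? : ∀ ts i y → Dec (Killed ts i y)
    killed? ts i y = (_ ≤? _) ×-dec ¬? (hit? ts i y)

    -- A window of length `block i` meets each residue class exactly once, so this is the indicator
    -- that the point of offset `t` in the window lies in `B`.
    landing : ℕ → ℕ → ℕ → ℕ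
    landing i y t = Σ< (block i) (λ j → 𝟙 (B? (y + j)) * 𝟙 (residue i (y + j) ≟ residue i t))

    -- If the window is missed, every offset has its point of the window in `B`, so every factor is
    -- positive.
    miss-≤-Π : ∀ ts i y → ¬ Hit ts i y → 1 ≤ Π (landing i y) ts
    miss-≤-Π []       i y miss = ≤-refl
    miss-≤-Π (t ∷ ts) i y miss = *-mono-≤ lands
      (miss-≤-Π ts i y λ (j , j<b , j∈N , j∉B) → miss (j , j<b , Any.there j∈N , j∉B))
      where
      lands : 1 ≤ landing i y t
      lands with j , j<b , eq ← Residues.∃-residue (block i) {{block≢0 i}} t y
            with B? (y + j) in eqB
      ... | yes j∈B = ≤-trans
              (≤-reflexive (sym (cong₂ _*_ (cong 𝟙 eqB) (𝟙-true (_ ≟ _) eq))))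
              (term≤Σ (block i) (λ j → 𝟙 (B? (y + j)) * 𝟙 (residue i (y + j) ≟ residue i t)) j<b)
      ... | no j∉B = ⊥-elim (miss (j , j<b , Any.here eq , j∉B))

    module _ (i q : ℕ) (M≡q*b : M ≡ q * block i) where

      -- Counted the other way round: each point of `B` in the window is met by exactly
      -- `q = M / block i` offsets. Divided by `M`, this is the density of `B` in the window.
      Σ-landing : ∀ y → Σ< M (landing i y) ≡ load i y * q
      Σ-landing y = begin
        Σ< M (λ t → Σ< b (λ j → 𝟙 (B? (y + j)) * 𝟙 (residue i (y + j) ≟ residue i t)))
          ≡⟨ Σ-comm M b _ ⟩
        Σ< b (λ j → Σ< M (λ t → 𝟙 (B? (y + j)) * 𝟙 (residue i (y + j) ≟ residue i t)))
          ≡⟨ Σ-cong b (λ j _ → *-distribˡ-Σ M (𝟙 (B? (y + j))) _) ⟨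
        Σ< b (λ j → 𝟙 (B? (y + j)) * Σ< M (λ t → 𝟙 (residue i (y + j) ≟ residue i t)))
          ≡⟨ Σ-cong b (λ j _ → cong (𝟙 (B? (y + j)) *_) (residues (y + j))) ⟩
        Σ< b (λ j → 𝟙 (B? (y + j)) * q)
          ≡⟨ *-distribʳ-Σ b q _ ⟨
        load i y * q ∎
        where
        open ≡-Reasoning
        b = block i
        residues : ∀ x → Σ< M (λ t → 𝟙 (residue i x ≟ residue i t)) ≡ q
        residues x = begin
          Σ< M (λ t → 𝟙 (residue i x ≟ residue i t))         ≡⟨ Σ-cong M (λ t _ → 𝟙-cong (_ ≟ _) (_ ≟ _) sym sym) ⟩
          Σ< M (λ t → 𝟙 (residue i t ≟ residue i x))         ≡⟨ cong (λ k → Σ< k (λ t → 𝟙 (residue i t ≟ residue i x))) M≡q*b ⟩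
          Σ< (q * b) (λ t → 𝟙 (residue i t ≟ residue i x))   ≡⟨ Residues.Σ-residue-blocks b {{block≢0 i}} x 0 q ⟩
          q                                                  ∎

      -- Since `M = q * block i`, division by `M ^ s` gives the bound `(load i y / block i) ^ s` on
      -- the probability of a miss.
      Σ-miss : ∀ y → Σ< (M ^ s) (λ r → 𝟙 (¬? (hit? (sample r) i y))) ≤ (load i y * q) ^ s
      Σ-miss y = begin
        Σ< (M ^ s) (λ r → 𝟙 (¬? (hit? (sample r) i y)))
          ≤⟨ Σ-mono (M ^ s) (λ r _ → 𝟙-≤ (¬? (hit? (sample r) i y)) (miss-≤-Π (sample r) i y)) ⟩
        Σ< (M ^ s) (λ r → Π (landing i y) (sample r))  ≡⟨ Σ-Π-digits (landing i y) s ⟩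
        Σ< M (landing i y) ^ s                         ≡⟨ cong (_^ s) (Σ-landing y) ⟩
        (load i y * q) ^ s                          ∎
        where open ≤-Reasoning

      Σ-load : Σ< n (λ y → load i y) ≤ block i * |B|
      Σ-load = begin
        Σ< n (λ y → Σ< b (λ j → 𝟙 (B? (y + j))))    ≡⟨ Σ-comm n b _ ⟩
        Σ< b (λ j → Σ< n (λ y → 𝟙 (B? (y + j))))    ≤⟨ Σ-≤-const b |B| (λ j _ → Σ-reindex n n _ (λ x → 𝟙 (B? x)) (_∸ j)
                                                         λ y _ 0<𝟙 → y + j , B⊆[n] (0<𝟙⇒ (B? (y + j)) 0<𝟙) ,
                                                           m+n∸n≡m y j , ≤-refl) ⟩
        b * |B|                                     ∎
        where
        open ≤-Reasoning
        b = block i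

      -- One of the `s = suc e` factors stays linear in the load, to be summed over `y`; sparsity
      -- bounds each of the other `e` by `a * M / suc a`. A dense window contributes nothing.
      Σ-killed-at : ∀ y → Σ< (M ^ s) (λ r → 𝟙 (killed? (sample r) i y)) * suc a ^ e ≤
                          load i y * (q * (a * M) ^ e)
      Σ-killed-at y = by-density (suc a * load i y ≤? a * block i)
        where
        open ≤-Reasoning
        K = load i y
        rearrange₁ : ∀ x y z → x * y * z ≡ z * x * y
        rearrange₁ = solve-∀
        rearrange₂ : ∀ x y z → x * y * z ≡ x * (z * y)
        rearrange₂ = solve-∀
        by-density : Dec (Sparse i y) → Σ< (M ^ s) (λ r → 𝟙 (killed? (sample r) i y)) * suc a ^ e ≤
                                        K * (q * (a * M) ^ e)
        by-density (no dense) = ≤-trans (≤-reflexive (cong (_* suc a ^ e) (trans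
          (Σ-cong (M ^ s) λ r _ → 𝟙-false (killed? (sample r) i y) (dense ∘ proj₁)) (Σ-zero (M ^ s))))) z≤n
        by-density (yes sparse) = begin
          Σ< (M ^ s) (λ r → 𝟙 (killed? (sample r) i y)) * suc a ^ e
            ≤⟨ *-monoˡ-≤ (suc a ^ e) (Σ-mono (M ^ s) λ r _ → 𝟙-≤ (killed? (sample r) i y) λ (_ , miss) →
                 ≤-reflexive (sym (𝟙-true (¬? (hit? (sample r) i y)) miss))) ⟩
          Σ< (M ^ s) (λ r → 𝟙 (¬? (hit? (sample r) i y))) * suc a ^ e
            ≤⟨ *-monoˡ-≤ (suc a ^ e) (Σ-miss y) ⟩
          (K * q) * (K * q) ^ e * suc a ^ e             ≡⟨ *-assoc (K * q) _ _ ⟩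
          (K * q) * ((K * q) ^ e * suc a ^ e)           ≡⟨ cong ((K * q) *_) (^-distribʳ-* e (K * q) (suc a)) ⟨
          (K * q) * (K * q * suc a) ^ e                 ≤⟨ *-monoʳ-≤ (K * q) (^-monoˡ-≤ e (begin
            K * q * suc a       ≡⟨ rearrange₁ K q (suc a) ⟩
            suc a * K * q       ≤⟨ *-monoˡ-≤ q sparse ⟩
            a * block i * q     ≡⟨ rearrange₂ a (block i) q ⟩
            a * (q * block i)   ≡⟨ cong (a *_) M≡q*b ⟨
            a * M               ∎)) ⟩
          (K * q) * (a * M) ^ e                         ≡⟨ *-assoc K q _ ⟩
          K * (q * (a * M) ^ e)                         ∎

      -- The linear factors add up to `block i * |B|`, and `q * block i = M` completes `M ^ s`. So a
      -- level has at most `|B| * (a / suc a) ^ e` killed windows on average, whatever `n` is.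
      Σ-killed : Σ< (M ^ s) (λ r → Σ< n (λ y → 𝟙 (killed? (sample r) i y))) * suc a ^ e ≤
                 M ^ s * a ^ e * |B|
      Σ-killed = begin
        Σ< (M ^ s) (λ r → Σ< n (λ y → 𝟙 (killed? (sample r) i y))) * suc a ^ e
          ≡⟨ cong (_* suc a ^ e) (Σ-comm (M ^ s) n (λ r y → 𝟙 (killed? (sample r) i y))) ⟩
        Σ< n (λ y → Σ< (M ^ s) (λ r → 𝟙 (killed? (sample r) i y))) * suc a ^ e
          ≡⟨ *-distribʳ-Σ n (suc a ^ e) _ ⟩
        Σ< n (λ y → Σ< (M ^ s) (λ r → 𝟙 (killed? (sample r) i y)) * suc a ^ e)
          ≤⟨ Σ-mono n (λ y _ → Σ-killed-at y) ⟩
        Σ< n (λ y → load i y * (q * (a * M) ^ e))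
          ≡⟨ *-distribʳ-Σ n (q * (a * M) ^ e) _ ⟨
        Σ< n (λ y → load i y) * (q * (a * M) ^ e)
          ≤⟨ *-monoˡ-≤ _ Σ-load ⟩
        block i * |B| * (q * (a * M) ^ e)             ≡⟨ cong (λ z → block i * |B| * (q * z)) (^-distribʳ-* e a M) ⟩
        block i * |B| * (q * (a ^ e * M ^ e))         ≡⟨ rearrange (block i) |B| q (a ^ e) (M ^ e) ⟩
        q * block i * M ^ e * a ^ e * |B|             ≡⟨ cong (λ z → z * M ^ e * a ^ e * |B|) M≡q*b ⟨
        M ^ s * a ^ e * |B|                           ∎
        where
        open ≤-Reasoning
        rearrange : ∀ b B q x y → b * B * (q * (x * y)) ≡ q * b * y * x * B
        rearrange = solve-∀

    -- The left score at `suc x` takes `x` itself into account. In `killedˡ` the window is the one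
    -- ending at `x`; `block i ≤ suc x` ensures that the subtraction does not truncate.
    data Lost (ts : List ℕ) (x : ℕ) : Set where
      shadowˡ : 0 < scoreˡ (suc x) → Lost ts x
      shadowʳ : 0 < scoreʳ (n ∸ x) x → Lost ts x
      killedʳ : ∀ {i} → i < h → Killed ts i x → Lost ts x
      killedˡ : ∀ {i} → i < h → block i ≤ suc x → Killed ts i (suc x ∸ block i) → Lost ts x

    opaque
      lost? : ∀ ts x → Dec (Lost ts x)
      lost? ts x = map′ to from
        (0 <? scoreˡ (suc x) ⊎-dec 0 <? scoreʳ (n ∸ x) x ⊎-dec
         anyUpTo? (λ i → killed? ts i x ⊎-dec (block i ≤? suc x ×-dec killed? ts i (suc x ∸ block i))) h)
        where
        Cases : Set
        Cases = 0 < scoreˡ (suc x) ⊎ 0 < scoreʳ (n ∸ x) x ⊎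
                ∃[ i ] i < h × (Killed ts i x ⊎ (block i ≤ suc x × Killed ts i (suc x ∸ block i)))
        to : Cases → Lost ts x
        to (inj₁ p)                                   = shadowˡ p
        to (inj₂ (inj₁ p))                            = shadowʳ p
        to (inj₂ (inj₂ (i , i<h , inj₁ k)))           = killedʳ i<h k
        to (inj₂ (inj₂ (i , i<h , inj₂ (b≤x , k))))   = killedˡ i<h b≤x k
        from : Lost ts x → Cases
        from (shadowˡ p)         = inj₁ p
        from (shadowʳ p)         = inj₂ (inj₁ p)
        from (killedʳ i<h k)     = inj₂ (inj₂ (_ , i<h , inj₁ k))
        from (killedˡ i<h b≤x k) = inj₂ (inj₂ (_ , i<h , inj₂ (b≤x , k)))

    -- A point of `B` turns the left score into a successor, so `shadowˡ` covers it.
    B⊆Lost : ∀ {ts x} → B x → Lost ts x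
    B⊆Lost {ts} {x} x∈B = shadowˡ (positive (B? x))
      where
      positive : (d : Dec (B x)) → 0 < step d (scoreˡ x)
      positive (yes _)   = z<s
      positive (no x∉B) = ⊥-elim (x∉B x∈B)

    -- A kept point has score 0, which makes its window sparse; a sparse window that is not killed
    -- is hit. The window has to fit into the path because `scoreʳ (n ∸ x) x` looks no further.
    hitʳ : ∀ {ts x i} → ¬ Lost ts x → i < h → x + block i ≤ n → Hit ts i x
    hitʳ {ts} {x} {i} kept i<h x+b≤n = decidable-stable (hit? ts i x) λ miss → kept (killedʳ i<h (sparse , miss))
      where
      open ≤-Reasoning
      sparse : Sparse i x
      sparse = begin
        suc a * load i x                      ≤⟨ windowʳ (m+n≤o⇒m≤o∸n (block i) (≤-trans (≤-reflexive (+-comm (block i) x)) x+b≤n)) x ⟩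
        scoreʳ (n ∸ x) x + a * block i           ≡⟨ cong (_+ a * block i) (n≤0⇒n≡0 (≮⇒≥ (kept ∘ shadowʳ))) ⟩
        a * block i                              ∎

    hitˡ : ∀ {ts x i} → ¬ Lost ts x → i < h → block i ≤ suc x → Hit ts i (suc x ∸ block i)
    hitˡ {ts} {x} {i} kept i<h b≤x = decidable-stable (hit? ts i y) λ miss → kept (killedˡ i<h b≤x (sparse , miss))
      where
      open ≤-Reasoning
      y = suc x ∸ block i
      sparse : Sparse i y
      sparse = begin
        suc a * load i y                      ≤⟨ windowˡ y (block i) ⟩
        scoreˡ (y + block i) + a * block i       ≡⟨ cong (λ z → scoreˡ z + a * block i) (m∸n+n≡m b≤x) ⟩
        scoreˡ (suc x) + a * block i             ≡⟨ cong (_+ a * block i) (n≤0⇒n≡0 (≮⇒≥ (kept ∘ shadowˡ))) ⟩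
        a * block i                              ∎

    |shadowˡ| |shadowʳ| : ℕ
    |shadowˡ| = Σ< n (λ x → 𝟙 (shadow? x (scoreˡ (suc x))))
    |shadowʳ| = Σ< n (λ x → 𝟙 (shadow? x (scoreʳ (n ∸ x) x)))

    #killed : List ℕ → ℕ
    #killed ts = Σ< h (λ i → Σ< n (λ y → 𝟙 (killed? ts i y)))

    -- A killed window is charged at most twice, by its first and by its last point.
    lost-count : ∀ ts → Σ< n (λ x → 𝟙 (lost? ts x)) ≤ |B| + |shadowˡ| + |shadowʳ| + 2 * #killed ts
    lost-count ts = begin
      Σ< n (λ x → 𝟙 (lost? ts x))
        ≤⟨ Σ-mono n (λ x _ → 𝟙-≤ (lost? ts x) (charge x)) ⟩
      Σ< n (λ x → 𝟙 (B? x) + 𝟙 (sˡ? x) + 𝟙 (sʳ? x) + (kʳ x + kˡ x))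
        ≡⟨ Σ-distrib-+ n _ _ ⟩
      Σ< n (λ x → 𝟙 (B? x) + 𝟙 (sˡ? x) + 𝟙 (sʳ? x)) + Σ< n (λ x → kʳ x + kˡ x)
        ≡⟨ cong₂ _+_ (trans (Σ-distrib-+ n _ _) (cong (_+ |shadowʳ|) (Σ-distrib-+ n _ _))) (Σ-distrib-+ n _ _) ⟩
      |B| + |shadowˡ| + |shadowʳ| + (Σ< n kʳ + Σ< n kˡ)
        ≤⟨ +-monoʳ-≤ (|B| + |shadowˡ| + |shadowʳ|) (+-mono-≤ (≤-reflexive (Σ-comm n h _)) Σkˡ) ⟩
      |B| + |shadowˡ| + |shadowʳ| + (#killed ts + #killed ts)
        ≡⟨ cong (λ k → |B| + |shadowˡ| + |shadowʳ| + (#killed ts + k)) (+-identityʳ (#killed ts)) ⟨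
      |B| + |shadowˡ| + |shadowʳ| + 2 * #killed ts ∎
      where
      open ≤-Reasoning
      sˡ? = λ x → shadow? x (scoreˡ (suc x))
      sʳ? = λ x → shadow? x (scoreʳ (n ∸ x) x)
      kˡ? : ∀ i x → Dec (block i ≤ suc x × Killed ts i (suc x ∸ block i))
      kˡ? i x = block i ≤? suc x ×-dec killed? ts i (suc x ∸ block i)
      kʳ kˡ : ℕ → ℕ
      kʳ x = Σ< h (λ i → 𝟙 (killed? ts i x))
      kˡ x = Σ< h (λ i → 𝟙 (kˡ? i x))
      charge-shadow : ∀ x k → 0 < k → 1 ≤ 𝟙 (B? x) + 𝟙 (shadow? x k)
      charge-shadow x k 0<k = by-membership (B? x) refl
        where
        by-membership : (d : Dec (B x)) → B? x ≡ d → 1 ≤ 𝟙 (B? x) + 𝟙 (shadow? x k)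
        by-membership (yes _)   eq = m≤n⇒m≤n+o _ (≤-reflexive (sym (cong 𝟙 eq)))
        by-membership (no x∉B) _  = m≤n⇒m≤o+n _ (≤-reflexive (sym (𝟙-true (shadow? x k) (x∉B , 0<k))))
      charge : ∀ x → Lost ts x → 1 ≤ 𝟙 (B? x) + 𝟙 (sˡ? x) + 𝟙 (sʳ? x) + (kʳ x + kˡ x)
      charge x (shadowˡ p) = m≤n⇒m≤n+o _ (m≤n⇒m≤n+o _ (charge-shadow x _ p))
      charge x (shadowʳ p) = m≤n⇒m≤n+o _ (≤-trans (charge-shadow x _ p) (+-monoˡ-≤ _ (m≤m+n (𝟙 (B? x)) _)))
      charge x (killedʳ {i} i<h k) = m≤n⇒m≤o+n (𝟙 (B? x) + 𝟙 (sˡ? x) + 𝟙 (sʳ? x)) (m≤n⇒m≤n+o (kˡ x)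
        (≤-trans (≤-reflexive (sym (𝟙-true (killed? ts i x) k))) (term≤Σ h (λ i → 𝟙 (killed? ts i x)) i<h)))
      charge x (killedˡ {i} i<h b≤x k) = m≤n⇒m≤o+n (𝟙 (B? x) + 𝟙 (sˡ? x) + 𝟙 (sʳ? x)) (m≤n⇒m≤o+n (kʳ x)
        (≤-trans (≤-reflexive (sym (𝟙-true (kˡ? i x) (b≤x , k)))) (term≤Σ h (λ i → 𝟙 (kˡ? i x)) i<h)))
      Σkˡ : Σ< n kˡ ≤ #killed ts
      Σkˡ = ≤-trans (≤-reflexive (Σ-comm n h (λ x i → 𝟙 (kˡ? i x)))) (Σ-mono h λ i _ →
        -- Only the last point `pred (y + block i)` charges the window that starts at `y`.
        Σ-reindex n n _ (λ y → 𝟙 (killed? ts i y)) (λ y → pred (y + block i)) λ x x<n 0<𝟙 →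
          let b≤x , k = 0<𝟙⇒ (kˡ? i x) 0<𝟙
          in suc x ∸ block i ,
             ≤-<-trans (∸-monoʳ-≤ (suc x) (>-nonZero⁻¹ (block i) {{block≢0 i}})) x<n ,
             cong pred (m∸n+n≡m b≤x) ,
             𝟙-≤ (kˡ? i x) λ _ → ≤-reflexive (sym (𝟙-true (killed? ts i (suc x ∸ block i)) k)))

    Σ-#killed : Σ< (M ^ s) (#killed ∘ sample) * suc a ^ e ≤ h * (M ^ s * a ^ e * |B|)
    Σ-#killed = begin
      Σ< (M ^ s) (#killed ∘ sample) * suc a ^ e
        ≡⟨ cong (_* suc a ^ e) (Σ-comm (M ^ s) h _) ⟩
      Σ< h (λ i → Σ< (M ^ s) (λ r → Σ< n (λ y → 𝟙 (killed? (sample r) i y)))) * suc a ^ e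
        ≡⟨ *-distribʳ-Σ h (suc a ^ e) _ ⟩
      Σ< h (λ i → Σ< (M ^ s) (λ r → Σ< n (λ y → 𝟙 (killed? (sample r) i y))) * suc a ^ e)
        ≤⟨ Σ-≤-const h _ (λ i i<h → let q , eq = block∣M (<⇒≤ i<h) in Σ-killed i q eq) ⟩
      h * (M ^ s * a ^ e * |B|) ∎
      where open ≤-Reasoning

    module _ (enough : 4 * h * N * a ^ e ≤ suc a ^ e) where

      Σ-#killed-≤ : a * Σ< (M ^ s) (#killed ∘ sample) ≤ M ^ s * |B|
      Σ-#killed-≤ = *-cancelʳ-≤ _ _ (suc a ^ e) {{m^n≢0 (suc a) e}} (begin
        a * F * suc a ^ e                       ≡⟨ *-assoc a F _ ⟩
        a * (F * suc a ^ e)                     ≤⟨ *-monoʳ-≤ a Σ-#killed ⟩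
        4 * N * (h * (T * a ^ e * |B|))         ≡⟨ rearrange N h T (a ^ e) |B| ⟩
        T * |B| * (4 * h * N * a ^ e)           ≤⟨ *-monoʳ-≤ (T * |B|) enough ⟩
        T * |B| * suc a ^ e                     ∎)
        where
        open ≤-Reasoning
        T = M ^ s
        F = Σ< T (#killed ∘ sample)
        rearrange : ∀ N h T x B → 4 * N * (h * (T * x * B)) ≡ T * B * (4 * h * N * x)
        rearrange = solve-∀

      -- Two shadows and two charges per killed window cost `|B| / a` each on average, together
      -- `|B| / N`. The factor 4 turns `N` into `a = 4 * N` and is cancelled at the end.
      Σ-lost : N * Σ< (M ^ s) (λ r → Σ< n (λ x → 𝟙 (lost? (sample r) x))) ≤ suc N * (M ^ s * |B|)
      Σ-lost = *-cancelˡ-≤ 4 (begin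
        4 * (N * Σ< T (λ r → Σ< n (λ x → 𝟙 (lost? (sample r) x))))
          ≤⟨ *-monoʳ-≤ 4 (*-monoʳ-≤ N (Σ-mono T λ r _ → lost-count (sample r))) ⟩
        4 * (N * Σ< T (λ r → |B| + |shadowˡ| + |shadowʳ| + 2 * #killed (sample r)))
          ≡⟨ cong (λ z → 4 * (N * z)) (trans (Σ-distrib-+ T _ _)
               (cong₂ _+_ (Σ-const T _) (sym (*-distribˡ-Σ T 2 _)))) ⟩
        4 * (N * (T * (|B| + |shadowˡ| + |shadowʳ|) + 2 * F))
          ≡⟨ rearrange₁ N T |B| |shadowˡ| |shadowʳ| F ⟩
        4 * N * (T * |B|) + (T * (a * |shadowˡ|) + T * (a * |shadowʳ|) + 2 * (a * F))
          ≤⟨ +-monoʳ-≤ (4 * N * (T * |B|)) (+-mono-≤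
               (+-mono-≤ (*-monoʳ-≤ T (m+n≤o⇒m≤o _ (shadowˡ-size n))) (*-monoʳ-≤ T (m+n≤o⇒m≤o _ (shadowʳ-size n 0))))
               (*-monoʳ-≤ 2 Σ-#killed-≤)) ⟩
        4 * N * (T * |B|) + (T * |B| + T * |B| + 2 * (T * |B|))
          ≡⟨ rearrange₂ N (T * |B|) ⟩
        4 * (suc N * (T * |B|)) ∎)
        where
        open ≤-Reasoning
        T = M ^ s
        F = Σ< T (#killed ∘ sample)
        rearrange₁ : ∀ N T B x y F → 4 * (N * (T * (B + x + y) + 2 * F)) ≡
                     4 * N * (T * B) + (T * (4 * N * x) + T * (4 * N * y) + 2 * (4 * N * F))
        rearrange₁ = solve-∀
        rearrange₂ : ∀ N z → 4 * N * z + (z + z + 2 * z) ≡ 4 * (suc N * z)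
        rearrange₂ = solve-∀

    -- Monotone walks between kept points.

    Step : List ℕ → ℕ → ℕ → Set
    Step ts x y = Edge ts x y × ¬ B x × ¬ B y

    -- At level 0 the window has length 1, so `u` is `x` and no step is spent; each further level
    -- costs at most one. The added step is an edge of level `i`, to which `u` belongs by nesting,
    -- and it goes upwards since `x + j < x + block i ≤ u`.
    climbʳ : ∀ {ts x u} i → ¬ Lost ts x → i < h → x + block i ≤ n →
      u ∈N[ i ] ts → ¬ B u → x ≤ u → u < x + block i → ∃[ k ] k ≤ i × Chain (Step ts) k x u
    climbʳ {ts} {x} {u} zero kept _ _ _ _ x≤u u<x+1
      with refl ← ≤-antisym x≤u (m<1+n⇒m≤n (≤-trans u<x+1 (≤-reflexive (+-comm x 1)))) = 0 , z≤n , []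
    climbʳ {ts} {x} {u} (suc i) kept i<h x+b≤n u∈N u∉B x≤u u<x+b with u <? x + block i
    ... | yes u<x+b′ with k , k≤i , c ← climbʳ i kept (<⇒≤ i<h) (≤-trans (+-monoʳ-≤ x (block-≤-suc i)) x+b≤n)
                                               (N-nested i u∈N) u∉B x≤u u<x+b′ = k , m≤n⇒m≤1+n k≤i , c
    ... | no  u≮x+b′ with j , j<b , z∈N , z∉B ← hitʳ kept (<⇒≤ i<h) (≤-trans (+-monoʳ-≤ x (block-≤-suc i)) x+b≤n)
                     with k , k≤i , c ← climbʳ i kept (<⇒≤ i<h) (≤-trans (+-monoʳ-≤ x (block-≤-suc i)) x+b≤n)
                                               z∈N z∉B (m≤m+n x j) (+-monoʳ-< x j<b) =
      k + 1 , ≤-trans (≤-reflexive (+-comm k 1)) (s≤s k≤i) , c ++ (last-edge , z∉B , u∉B) ∷ []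
      where
      last-edge : Edge ts (x + j) u
      last-edge = <-≤-trans (+-monoʳ-< x j<b) (≮⇒≥ u≮x+b′) , i , <⇒≤ i<h ,
        edgeAt (≤-trans (block-≤-suc i) (m+n≤o⇒n≤o x x+b≤n)) z∈N (N-nested i u∈N)
               (<-≤-trans u<x+b (+-monoˡ-≤ _ (m≤m+n x j)))

    window-≤ : ∀ {y j} i → block i ≤ suc y → j < block i → suc y ∸ block i + j ≤ y
    window-≤ {y} i b≤y j<b = s≤s⁻¹ (≤-trans (+-monoʳ-< (suc y ∸ block i) j<b) (≤-reflexive (m∸n+n≡m b≤y)))

    window-> : ∀ y i j → y < suc y ∸ block i + j + block i
    window-> y i j = ≤-trans (m≤n+m∸n (suc y) (block i)) (≤-trans (≤-reflexive (+-comm (block i) _))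
      (+-monoˡ-≤ (block i) (m≤m+n (suc y ∸ block i) j)))

    climbˡ : ∀ {ts y v} i → ¬ Lost ts y → i < h → y < n → block i ≤ suc y →
      v ∈N[ i ] ts → ¬ B v → v ≤ y → y < v + block i → ∃[ k ] k ≤ i × Chain (Step ts) k v y
    climbˡ {ts} {y} {v} zero kept _ _ _ _ _ v≤y y<v+1
      with refl ← ≤-antisym v≤y (m<1+n⇒m≤n (≤-trans y<v+1 (≤-reflexive (+-comm v 1)))) = 0 , z≤n , []
    climbˡ {ts} {y} {v} (suc i) kept i<h y<n b≤y v∈N v∉B v≤y y<v+b with y <? v + block i
    ... | yes y<v+b′ with k , k≤i , c ← climbˡ i kept (<⇒≤ i<h) y<n (≤-trans (block-≤-suc i) b≤y)
                                               (N-nested i v∈N) v∉B v≤y y<v+b′ = k , m≤n⇒m≤1+n k≤i , c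
    ... | no  y≮v+b′ with j , j<b , z∈N , z∉B ← hitˡ kept (<⇒≤ i<h) (≤-trans (block-≤-suc i) b≤y)
                     with k , k≤i , c ← climbˡ i kept (<⇒≤ i<h) y<n (≤-trans (block-≤-suc i) b≤y) z∈N z∉B
                                          (window-≤ i (≤-trans (block-≤-suc i) b≤y) j<b) (window-> y i j) =
      suc k , s≤s k≤i , (first-edge , v∉B , z∉B) ∷ c
      where
      first-edge : Edge ts v (suc y ∸ block i + j)
      first-edge = +-cancelʳ-< (block i) v _ (≤-<-trans (≮⇒≥ y≮v+b′) (window-> y i j)) , i , <⇒≤ i<h ,
        edgeAt (≤-trans (block-≤-suc i) (≤-trans b≤y y<n)) (N-nested i v∈N) z∈N
               (≤-<-trans (window-≤ i (≤-trans (block-≤-suc i) b≤y) j<b) y<v+b)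

    scale : ∀ {x y} i → x < y → y < x + block i → ∃[ j ] j < i × x + block j ≤ y × y < x + block (suc j)
    scale {x} {y} zero x<y y<x+1 = ⊥-elim (<-irrefl refl (<-≤-trans y<x+1
      (≤-trans (≤-reflexive (+-comm x 1)) x<y)))
    scale {x} {y} (suc i) x<y y<x+b with y <? x + block i
    ... | no  y≮ = i , ≤-refl , ≮⇒≥ y≮ , y<x+b
    ... | yes y< with j , j<i , p ← scale i x<y y< = j , m<n⇒m<1+n j<i , p

    -- From `n ≤ δ ^ h ≤ block h`, every distance is below the top block and `scale` finds a level
    -- `i < h`. The points to which the two ends climb lie between `x` and `y`, hence less than
    -- `block (suc i)` apart.
    chain : ∀ {ts x y} → n ≤ δ ^ h → ¬ Lost ts x → ¬ Lost ts y → x < y → y < n →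
            ∃[ k ] k ≤ 2 * h + 1 × Chain (Step ts) k x y
    chain {ts} {x} {y} n≤δ^h keptˣ keptʸ x<y y<n
      with i , i<h , x+b≤y , y<x+b ← scale h x<y
             (<-≤-trans y<n (≤-trans n≤δ^h (≤-trans (δ^≤block h) (m≤n+m _ x))))
      with j , j<b , u∈N , u∉B ← hitʳ keptˣ i<h (≤-trans x+b≤y (<⇒≤ y<n))
         | l , l<b , v∈N , v∉B ← hitˡ keptʸ i<h (≤-trans (m+n≤o⇒n≤o x x+b≤y) (n≤1+n y))
      = join (climbʳ i keptˣ i<h (≤-trans x+b≤y (<⇒≤ y<n)) u∈N u∉B (m≤m+n x j) u<x+b) (u <? v)
      where
      u v : ℕ
      u = x + j
      v = suc y ∸ block i + l
      b≤1+y : block i ≤ suc y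
      b≤1+y = ≤-trans (m+n≤o⇒n≤o x x+b≤y) (n≤1+n y)
      u<x+b : u < x + block i
      u<x+b = +-monoʳ-< x j<b
      v≤y : v ≤ y
      v≤y = window-≤ i b≤1+y l<b
      y<v+b : y < v + block i
      y<v+b = window-> y i l
      join : ∃[ k ] k ≤ i × Chain (Step ts) k x u → Dec (u < v) → ∃[ k ] k ≤ 2 * h + 1 × Chain (Step ts) k x y
      join (k , k≤i , c) (yes u<v) with k′ , k′≤i , c′ ← climbˡ i keptʸ i<h y<n b≤1+y v∈N v∉B v≤y y<v+b =
        k + suc k′ ,
        ≤-trans (+-mono-≤ (≤-trans k≤i (<⇒≤ i<h)) (s≤s (≤-trans k′≤i (<⇒≤ i<h)))) (≤-reflexive (double h)) ,
        c ++ ((u<v , i , i<h , edgeAt (≤-trans (m+n≤o⇒n≤o x x+b≤y) (<⇒≤ y<n)) u∈N v∈N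
                (≤-<-trans v≤y (<-≤-trans y<x+b (+-monoˡ-≤ _ (m≤m+n x j))))) , u∉B , v∉B) ∷ c′
        where
        double : ∀ h → h + suc h ≡ 2 * h + 1
        double = solve-∀
      -- The windows overlap: `v ≤ u` puts `u` within `block i` of `y`, so `y` is reached from `u`
      -- itself, without a middle edge.
      join (k , k≤i , c) (no u≮v) with k′ , k′≤i , c′ ← climbˡ i keptʸ i<h y<n b≤1+y u∈N u∉B
             (≤-trans (<⇒≤ u<x+b) x+b≤y) (<-≤-trans y<v+b (+-monoˡ-≤ (block i) (≮⇒≥ u≮v))) =
        k + k′ , ≤-trans (+-mono-≤ (≤-trans k≤i (<⇒≤ i<h)) (≤-trans k′≤i (<⇒≤ i<h)))
                         (≤-trans (≤-reflexive (cong (h +_) (sym (+-identityʳ h)))) (m≤m+n (2 * h) 1)) ,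
        c ++ c′

open Combinatorics

-- Minimal witnesses, subsets as predicates, and separation by edges.

-- Stands in for rounding up quotients, logarithms and roots: failure below the witness is what
-- bounds it from above.
least : ∀ {p} {P : Pred ℕ p} → Decidable P → ∀ k → P k → ∃[ m ] P m × (∀ {j} → j ℕ.< m → ¬ P j)
least P? zero    p = 0 , p , λ ()
least P? (suc k) p with P? 0
... | yes p₀ = 0 , p₀ , λ ()
... | no ¬p₀ with m , pm , min ← least (P? ∘ suc) k p =
  suc m , pm , λ { {zero} _ → ¬p₀ ; {suc j} j<m → min (ℕₚ.≤-pred j<m) }

2≤n : ∀ {n h} → 1 ℕ.≤ h → h ℕ.≤ ⌊log₂ n ⌋ → 2 ℕ.≤ n
2≤n {zero}        1≤h h≤log = ⊥-elim (ℕₚ.<⇒≱ 1≤h h≤log)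
2≤n {suc zero}    1≤h h≤log = ⊥-elim (ℕₚ.<⇒≱ 1≤h h≤log)
2≤n {suc (suc n)} _   _     = s≤s (s≤s z≤n)

module ℕΣ = RangeSum ℕₚ.+-*-commutativeSemiring

-- A predicate on all of ℕ, false from `n` on, so that windows may run past the end of the path.
Member : ∀ {n} → Subset n → ℕ → Set
Member []      x       = ⊥
Member (b ∷ p) zero    = b ≡ true
Member (b ∷ p) (suc x) = Member p x

member? : ∀ {n} (p : Subset n) → Decidable (Member p)
member? []      x       = no λ ()
member? (b ∷ p) zero    = b Bool.≟ true
member? (b ∷ p) (suc x) = member? p x

Member⇒< : ∀ {n} (p : Subset n) {x} → Member p x → x ℕ.< n
Member⇒< (b ∷ p) {zero}  _   = s≤s z≤n
Member⇒< (b ∷ p) {suc x} x∈p = s≤s (Member⇒< p x∈p)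

∈⇒Member : ∀ {n} {p : Subset n} {i} → i ∈ p → Member p (toℕ i)
∈⇒Member here        = ≡.refl
∈⇒Member (there i∈p) = ∈⇒Member i∈p

∣p∣≡Σ : ∀ {n} (p : Subset n) → ∣ p ∣ ≡ ℕΣ.Σ< n (λ x → 𝟙 (member? p x))
∣p∣≡Σ []          = ≡.refl
∣p∣≡Σ (true  ∷ p) = ≡.cong suc (∣p∣≡Σ p)
∣p∣≡Σ (false ∷ p) = ∣p∣≡Σ p

module _ {ℓ} {Q : Pred ℕ ℓ} where

  select : Decidable Q → ∀ n → Subset n
  select Q? n = tabulate (λ i → does (Q? (toℕ i)))

  select-∈ : (Q? : Decidable Q) → ∀ {n} {i : Fin n} → Q (toℕ i) → i ∈ select Q? n
  select-∈ Q? {i = i} q = lookup⇒[]= i _ (≡.trans (lookup∘tabulate _ i) (dec-true (Q? (toℕ i)) q))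

∣select∣ : ∀ {ℓ} {Q : Pred ℕ ℓ} (Q? : Decidable Q) n → ∣ select Q? n ∣ ≡ ℕΣ.Σ< n (λ x → 𝟙 (Q? x))
∣select∣ Q? zero    = ≡.refl
∣select∣ Q? (suc n) with Q? 0 | ∣select∣ (Q? ∘ suc) n
... | yes _ | eq = ≡.cong suc eq
... | no  _ | eq = eq

chain-≤ : ∀ {_⟶_ : ℕ → ℕ → Set} → (∀ {x y} → x ⟶ y → x ℕ.< y) → ∀ {k x y} → Chain _⟶_ k x y → x ℕ.≤ y
chain-≤ inc []      = ℕₚ.≤-refl
chain-≤ inc (e ∷ c) = ℕₚ.≤-trans (ℕₚ.<⇒≤ (inc e)) (chain-≤ inc c)

-- The indicator of u ≤ e < v or v ≤ e < u, in a form that makes the triangle inequality evident.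
separates : ℕ → ℕ → ℕ → ℕ
separates u v e = ∣ 𝟙 (e ℕₚ.<? u) - 𝟙 (e ℕₚ.<? v) ∣

separates-+ : ∀ {x y z} e → x ℕ.≤ y → y ℕ.≤ z → separates x y e ℕ.+ separates y z e ≡ separates x z e
separates-+ {x} {y} {z} e x≤y y≤z with e ℕₚ.<? x | e ℕₚ.<? y | e ℕₚ.<? z
... | yes _   | yes _   | yes _   = ≡.refl
... | no  _   | yes _   | yes _   = ≡.refl
... | no  _   | no  _   | yes _   = ≡.refl
... | no  _   | no  _   | no  _   = ≡.refl
... | yes e<x | no  e≮y | _       = ⊥-elim (e≮y (ℕₚ.<-≤-trans e<x x≤y))
... | _       | yes e<y | no  e≮z = ⊥-elim (e≮z (ℕₚ.<-≤-trans e<y y≤z))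

separates-suc : ∀ x e → separates x (suc x) e ≡ 𝟙 (e ℕₚ.≟ x)
separates-suc x e with e ℕₚ.<? x | e ℕₚ.<? suc x | e ℕₚ.≟ x
... | yes e<x | _         | yes ≡.refl = ⊥-elim (ℕₚ.<-irrefl ≡.refl e<x)
... | no  _   | no  e≮    | yes ≡.refl = ⊥-elim (e≮ ℕₚ.≤-refl)
... | no  _   | yes _     | yes _      = ≡.refl
... | yes _   | yes _     | no  _      = ≡.refl
... | no  _   | no  _     | no  _      = ≡.refl
... | yes e<x | no  e≮    | _          = ⊥-elim (e≮ (ℕₚ.m<n⇒m<1+n e<x))
... | no  e≮x | yes e<1+x | no  e≢x    = ⊥-elim (e≮x (ℕₚ.≤∧≢⇒< (ℕₚ.≤-pred e<1+x) e≢x))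

separates-≤ : ∀ {u v} e → u ℕ.< v → separates u v e ℕ.≤ 𝟙 (u ℕₚ.≤? e ×-dec e ℕₚ.<? v)
separates-≤ {u} {v} e u<v with e ℕₚ.<? u | e ℕₚ.<? v
... | yes e<u | no  e≮v = ⊥-elim (e≮v (ℕₚ.<-trans e<u u<v))
... | yes _   | yes _   = z≤n
... | no  _   | no  _   = z≤n
... | no  e≮u | yes e<v = ℕₚ.≤-reflexive (≡.sym (𝟙-true (u ℕₚ.≤? e ×-dec yes e<v) (ℕₚ.≮⇒≥ e≮u , e<v)))

guarded-just : ∀ {q a} {Q : Set q} {A : Set a} {x w : A} (d : Dec Q) →
               (if does d then just x else nothing) ≡ just w → Q × x ≡ w
guarded-just (yes q) eq = q , just-injective eq

-- Arithmetic of the scalars.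

module OverField {c ℓ₁ ℓ₂} (F : ArchimedeanOrderedField c ℓ₁ ℓ₂) where
  open ArchimedeanOrderedField F hiding (refl; sym; trans; zero)
  open Spanners F
  private module F = ArchimedeanOrderedField F
  open RangeSum commutativeSemiring
  open RingProperties ring using (-‿distribʳ-*; -‿distribˡ-*; -‿involutive)
  open SemiringMult semiring using (×-homo-+; ×1-homo-*)
  open IsDecTotalOrder isDecTotalOrder public
    using (total; antisym; isPartialOrder; _≤?_)
    renaming (refl to ≤-refl; reflexive to ≤-reflexive; trans to ≤-trans; isPreorder to ≤-isPreorder)

  poset : Poset c ℓ₁ ℓ₂
  poset = record { isPartialOrder = isPartialOrder }

  module ≤-Reasoning = PosetReasoning poset
  open ≤-Reasoning

  +-mono-≤ : ∀ {x y u v} → x ≤ y → u ≤ v → x + u ≤ y + v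
  +-mono-≤ {x} {y} {u} {v} x≤y u≤v = begin
    x + u  ≤⟨ +-monoʳ-≤ x u≤v ⟩
    x + v  ≈⟨ +-comm x v ⟩
    v + x  ≤⟨ +-monoʳ-≤ v x≤y ⟩
    v + y  ≈⟨ +-comm v y ⟩
    y + v  ∎

  open Ordered _≤_ ≤-isPreorder +-mono-≤

  x≤y⇒0≤y-x : ∀ {x y} → x ≤ y → 0# ≤ y - x
  x≤y⇒0≤y-x {x} {y} x≤y = begin
    0#     ≈⟨ -‿inverseʳ x ⟨
    x - x  ≤⟨ +-mono-≤ x≤y ≤-refl ⟩
    y - x  ∎

  0≤y-x⇒x≤y : ∀ {x y} → 0# ≤ y - x → x ≤ y
  0≤y-x⇒x≤y {x} {y} 0≤y-x = begin
    x            ≈⟨ +-identityʳ x ⟨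
    x + 0#       ≤⟨ +-monoʳ-≤ x 0≤y-x ⟩
    x + (y - x)  ≈⟨ +-congˡ (+-comm y (- x)) ⟩
    x + (- x + y) ≈⟨ +-assoc x (- x) y ⟨
    x - x + y    ≈⟨ +-congʳ (-‿inverseʳ x) ⟩
    0# + y       ≈⟨ +-identityˡ y ⟩
    y            ∎

  *-monoˡ-≤ : ∀ {x y z} → 0# ≤ z → x ≤ y → z * x ≤ z * y
  *-monoˡ-≤ {x} {y} {z} 0≤z x≤y = 0≤y-x⇒x≤y (begin
    0#              ≤⟨ *-nonNegative 0≤z (x≤y⇒0≤y-x x≤y) ⟩
    z * (y - x)     ≈⟨ distribˡ z y (- x) ⟩
    z * y + z * - x ≈⟨ +-congˡ (-‿distribʳ-* z x) ⟨
    z * y - z * x   ∎)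

  *-monoʳ-≤ : ∀ {x y z} → 0# ≤ z → x ≤ y → x * z ≤ y * z
  *-monoʳ-≤ {x} {y} {z} 0≤z x≤y = begin
    x * z ≈⟨ *-comm x z ⟩
    z * x ≤⟨ *-monoˡ-≤ 0≤z x≤y ⟩
    z * y ≈⟨ *-comm z y ⟩
    y * z ∎

  *-mono-≤ : ∀ {x y u v} → 0# ≤ y → 0# ≤ u → x ≤ y → u ≤ v → x * u ≤ y * v
  *-mono-≤ 0≤y 0≤u x≤y u≤v = ≤-trans (*-monoʳ-≤ 0≤u x≤y) (*-monoˡ-≤ 0≤y u≤v)

  0≤1 : 0# ≤ 1#
  0≤1 with total 0# 1#
  ... | inj₁ 0≤1 = 0≤1
  ... | inj₂ 1≤0 = begin
    0#             ≤⟨ *-nonNegative 0≤-1 0≤-1 ⟩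
    - 1# * - 1#    ≈⟨ -‿distribˡ-* 1# (- 1#) ⟨
    - (1# * - 1#)  ≈⟨ -‿cong (*-identityˡ (- 1#)) ⟩
    - - 1#         ≈⟨ -‿involutive 1# ⟩
    1#             ∎
    where
    0≤-1 : 0# ≤ - 1#
    0≤-1 = ≤-trans (x≤y⇒0≤y-x 1≤0) (≤-reflexive (+-identityˡ (- 1#)))

  1≰0 : ¬ 1# ≤ 0#
  1≰0 1≤0 = 1≉0 (antisym 1≤0 0≤1)

  ≰⇒≥ : ∀ {x y} → ¬ x ≤ y → y ≤ x
  ≰⇒≥ {x} {y} x≰y with total x y
  ... | inj₁ x≤y = ⊥-elim (x≰y x≤y)
  ... | inj₂ y≤x = y≤x

  ≰⇒> : ∀ {x y} → ¬ x ≤ y → y < x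
  ≰⇒> x≰y = ≰⇒≥ x≰y , λ y≈x → x≰y (≤-reflexive (F.sym y≈x))

  <-respʳ-≈ : ∀ {x y z} → y ≈ z → x < y → x < z
  <-respʳ-≈ y≈z (x≤y , x≉y) = ≤-trans x≤y (≤-reflexive y≈z) , λ x≈z → x≉y (F.trans x≈z (F.sym y≈z))

  +-positive : ∀ {x y} → 0# < x → 0# ≤ y → 0# < x + y
  +-positive {x} {y} (0≤x , 0≉x) 0≤y =
    ≤-trans 0≤x x≤x+y , λ 0≈x+y → 0≉x (antisym 0≤x (≤-trans x≤x+y (≤-reflexive (F.sym 0≈x+y))))
    where
    x≤x+y : x ≤ x + y
    x≤x+y = ≤-trans (≤-reflexive (F.sym (+-identityʳ x))) (+-monoʳ-≤ x 0≤y)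

  ι-+ : ∀ m n → ι (m ℕ.+ n) ≈ ι m + ι n
  ι-+ = ×-homo-+ 1#

  ι-* : ∀ m n → ι (m ℕ.* n) ≈ ι m * ι n
  ι-* = ×1-homo-*

  ι-1 : ι 1 ≈ 1#
  ι-1 = +-identityʳ 1#

  ι-^ : ∀ m k → ι (m ℕ.^ k) ≈ ι m ^ k
  ι-^ m zero    = ι-1
  ι-^ m (suc k) = F.trans (ι-* m (m ℕ.^ k)) (*-congˡ (ι-^ m k))

  0≤ι : ∀ k → 0# ≤ ι k
  0≤ι zero    = ≤-refl
  0≤ι (suc k) = ≤-trans (≤-reflexive (F.sym (+-identityʳ 0#))) (+-mono-≤ 0≤1 (0≤ι k))

  ι-mono : ∀ {m n} → m ℕ.≤ n → ι m ≤ ι n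
  ι-mono {n = n} z≤n   = 0≤ι n
  ι-mono (s≤s m≤n)     = +-monoʳ-≤ 1# (ι-mono m≤n)

  ι-cancel-≤ : ∀ {m n} → ι m ≤ ι n → m ℕ.≤ n
  ι-cancel-≤ {m} {n} ιm≤ιn = ℕₚ.≮⇒≥ λ n<m → 1≰0 (begin
    1#                 ≈⟨ +-identityʳ 1# ⟨
    1# + 0#            ≈⟨ +-congˡ (-‿inverseʳ (ι n)) ⟨
    1# + (ι n - ι n)   ≈⟨ +-assoc 1# (ι n) (- ι n) ⟨
    ι (suc n) - ι n    ≤⟨ +-mono-≤ (≤-trans (ι-mono n<m) ιm≤ιn) ≤-refl ⟩
    ι n - ι n          ≈⟨ -‿inverseʳ (ι n) ⟩
    0#                 ∎)

  0<ι : ∀ {k} → 1 ℕ.≤ k → 0# < ι k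
  0<ι {k} 1≤k = 0≤ι k , λ 0≈ιk → ℕₚ.<-irrefl ≡.refl
    (ℕₚ.≤-trans 1≤k (ι-cancel-≤ {k} {0} (≤-reflexive (F.sym 0≈ιk))))

  ^-nonNegative : ∀ {x} k → 0# ≤ x → 0# ≤ x ^ k
  ^-nonNegative zero    0≤x = 0≤1
  ^-nonNegative (suc k) 0≤x = *-nonNegative 0≤x (^-nonNegative k 0≤x)

  ^-monoˡ-≤ : ∀ {x y} k → 0# ≤ x → x ≤ y → x ^ k ≤ y ^ k
  ^-monoˡ-≤ zero    0≤x x≤y = ≤-refl
  ^-monoˡ-≤ (suc k) 0≤x x≤y = *-mono-≤ (≤-trans 0≤x x≤y) (^-nonNegative k 0≤x) x≤y (^-monoˡ-≤ k 0≤x x≤y)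

  module _ {x} (0<x : 0# < x) where

    inverseʳ : x * x ⁻¹ ≈ 1#
    inverseʳ = ⁻¹-inverseʳ (λ x≈0 → proj₂ 0<x (F.sym x≈0))

    0≤⁻¹ : 0# ≤ x ⁻¹
    0≤⁻¹ with total 0# (x ⁻¹)
    ... | inj₁ 0≤x⁻¹ = 0≤x⁻¹
    ... | inj₂ x⁻¹≤0 = ⊥-elim (1≰0 (begin
      1#        ≈⟨ inverseʳ ⟨
      x * x ⁻¹  ≤⟨ *-monoˡ-≤ (proj₁ 0<x) x⁻¹≤0 ⟩
      x * 0#    ≈⟨ zeroʳ x ⟩
      0#        ∎))

    0<⁻¹ : 0# < x ⁻¹
    0<⁻¹ = 0≤⁻¹ , λ 0≈x⁻¹ → 1≉0 (F.trans (F.sym inverseʳ) (F.trans (*-congˡ (F.sym 0≈x⁻¹)) (zeroʳ x)))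

    *-≤⇒≤-/ : ∀ {y z} → y * x ≤ z → y ≤ z / x
    *-≤⇒≤-/ {y} {z} yx≤z = begin
      y               ≈⟨ *-identityʳ y ⟨
      y * 1#          ≈⟨ *-congˡ inverseʳ ⟨
      y * (x * x ⁻¹)  ≈⟨ *-assoc y x (x ⁻¹) ⟨
      y * x * x ⁻¹    ≤⟨ *-monoʳ-≤ 0≤⁻¹ yx≤z ⟩
      z / x           ∎

    *-cancelʳ-≤ : ∀ {y z} → y * x ≤ z * x → y ≤ z
    *-cancelʳ-≤ {y} {z} yx≤zx = begin
      y               ≤⟨ *-≤⇒≤-/ yx≤zx ⟩
      z * x * x ⁻¹    ≈⟨ *-assoc z x (x ⁻¹) ⟩
      z * (x * x ⁻¹)  ≈⟨ *-congˡ inverseʳ ⟩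
      z * 1#          ≈⟨ *-identityʳ z ⟩
      z               ∎

  -- The calculus of constants: x = O(u) in the form x ≤ ι a * u.

  bound-+ : ∀ a b {x y u} → x ≤ ι a * u → y ≤ ι b * u → x + y ≤ ι (a ℕ.+ b) * u
  bound-+ a b {x} {y} {u} x≤au y≤bu = begin
    x + y              ≤⟨ +-mono-≤ x≤au y≤bu ⟩
    ι a * u + ι b * u  ≈⟨ distribʳ u (ι a) (ι b) ⟨
    (ι a + ι b) * u    ≈⟨ *-congʳ (ι-+ a b) ⟨
    ι (a ℕ.+ b) * u    ∎

  bound-* : ∀ a b {x y u v} → 0# ≤ x → 0# ≤ y → x ≤ ι a * u → y ≤ ι b * v → x * y ≤ ι (a ℕ.* b) * (u * v)
  bound-* a b {x} {y} {u} {v} 0≤x 0≤y x≤au y≤bv = begin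
    x * y                    ≤⟨ *-mono-≤ (≤-trans 0≤x x≤au) 0≤y x≤au y≤bv ⟩
    ι a * u * (ι b * v)      ≈⟨ interchange (ι a) u (ι b) v ⟩
    ι a * ι b * (u * v)      ≈⟨ *-congʳ (ι-* a b) ⟨
    ι (a ℕ.* b) * (u * v)    ∎
    where open CommSemigroup *-commutativeSemigroup using (interchange)

  bound-1 : ∀ {x u} → x ≤ u → x ≤ ι 1 * u
  bound-1 {x} {u} x≤u = begin
    x        ≤⟨ x≤u ⟩
    u        ≈⟨ *-identityˡ u ⟨
    1# * u   ≈⟨ *-congʳ ι-1 ⟨
    ι 1 * u  ∎

  bound-const : ∀ a {u} → 1# ≤ u → ι a ≤ ι a * u
  bound-const a 1≤u = ≤-trans (≤-reflexive (F.sym (*-identityʳ (ι a)))) (*-monoˡ-≤ (0≤ι a) 1≤u)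

  open CommSemigroup *-commutativeSemigroup using (xy∙z≈x∙zy)

  -- Turns an expectation under a uniform distribution into a count in ℕ.
  sum-scaled : ∀ k p (t : Fin k → Carrier) (f : ℕ → ℕ) → (∀ i → t i ≈ p * ι (f (toℕ i))) →
               sum t ≈ p * ι (ℕΣ.Σ< k f)
  sum-scaled zero    p t f t≈ = F.sym (zeroʳ p)
  sum-scaled (suc k) p t f t≈ = begin-equality
    t zero + sum (t ∘ suc)                          ≈⟨ +-cong (t≈ zero) (sum-scaled k p (t ∘ suc) (f ∘ suc) (t≈ ∘ suc)) ⟩
    p * ι (f 0) + p * ι (ℕΣ.Σ< k (f ∘ suc))         ≈⟨ distribˡ p _ _ ⟨
    p * (ι (f 0) + ι (ℕΣ.Σ< k (f ∘ suc)))           ≈⟨ *-congˡ (ι-+ (f 0) _) ⟨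
    p * ι (ℕΣ.Σ< (suc k) f)                         ∎

  module _ (T : ℕ) (1≤T : 1 ℕ.≤ T) where

    sum-uniform : sum {T} (λ _ → ι T ⁻¹) ≈ 1#
    sum-uniform = begin-equality
      sum {T} (λ _ → ι T ⁻¹)               ≈⟨ sum-scaled T (ι T ⁻¹) _ (λ _ → 1) (λ _ →
                                                F.sym (F.trans (*-congˡ ι-1) (*-identityʳ (ι T ⁻¹)))) ⟩
      ι T ⁻¹ * ι (ℕΣ.Σ< T (λ _ → 1))       ≈⟨ *-congˡ (reflexive (≡.cong ι (≡.trans (Σ-const T 1) (ℕₚ.*-identityʳ T)))) ⟩
      ι T ⁻¹ * ι T                         ≈⟨ *-comm (ι T ⁻¹) (ι T) ⟩
      ι T * ι T ⁻¹                         ≈⟨ inverseʳ (0<ι 1≤T) ⟩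
      1#                                   ∎

    -- After multiplication by `T` and `N` the hypothesis in ℕ applies, and `1 ≤ N ν` gives
    -- `1 + N ≤ N (1 + ν)`.
    average-≤ : ∀ {N ν b S} → 1 ℕ.≤ N → 1# ≤ ι N * ν → N ℕ.* S ℕ.≤ suc N ℕ.* (T ℕ.* b) →
                ι T ⁻¹ * ι S ≤ (1# + ν) * ι b
    average-≤ {N} {ν} {b} {S} 1≤N 1≤Nν NS≤ = *-cancelʳ-≤ (0<ι 1≤T) (*-cancelʳ-≤ (0<ι 1≤N) (begin
      ι T ⁻¹ * ι S * ι T * ι N             ≈⟨ *-congʳ (xy∙z≈x∙zy (ι T ⁻¹) (ι S) (ι T)) ⟩
      ι T ⁻¹ * (ι T * ι S) * ι N           ≈⟨ *-congʳ (*-assoc (ι T ⁻¹) (ι T) (ι S)) ⟨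
      ι T ⁻¹ * ι T * ι S * ι N             ≈⟨ *-congʳ (*-congʳ (F.trans (*-comm (ι T ⁻¹) (ι T)) (inverseʳ (0<ι 1≤T)))) ⟩
      1# * ι S * ι N                       ≈⟨ *-congʳ (*-identityˡ (ι S)) ⟩
      ι S * ι N                            ≈⟨ *-comm (ι S) (ι N) ⟩
      ι N * ι S                            ≈⟨ ι-* N S ⟨
      ι (N ℕ.* S)                          ≤⟨ ι-mono NS≤ ⟩
      ι (suc N ℕ.* (T ℕ.* b))              ≈⟨ F.trans (ι-* (suc N) (T ℕ.* b)) (*-congˡ (ι-* T b)) ⟩
      (1# + ι N) * (ι T * ι b)             ≤⟨ *-monoʳ-≤ (*-nonNegative (0≤ι T) (0≤ι b)) (+-mono-≤ 1≤Nν
                                                (≤-reflexive (F.sym (*-identityʳ (ι N))))) ⟩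
      (ι N * ν + ι N * 1#) * (ι T * ι b)   ≈⟨ *-congʳ (distribˡ (ι N) ν 1#) ⟨
      ι N * (ν + 1#) * (ι T * ι b)         ≈⟨ *-congʳ (*-congˡ (+-comm ν 1#)) ⟩
      ι N * (1# + ν) * (ι T * ι b)         ≈⟨ *-assoc (ι N) (1# + ν) _ ⟩
      ι N * ((1# + ν) * (ι T * ι b))       ≈⟨ *-comm (ι N) _ ⟩
      (1# + ν) * (ι T * ι b) * ι N         ≈⟨ *-congʳ (xy∙z≈x∙zy (1# + ν) (ι b) (ι T)) ⟨
      (1# + ν) * ι b * ι T * ι N           ∎))

  -- Choice and size of the parameters.

  module Parameters
    (ν : Carrier) (0<ν : 0# < ν) (ν<1 : ν < 1#)
    (n h : ℕ) (1≤h : 1 ℕ.≤ h) (2≤n : 2 ℕ.≤ n) where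


    private
      least-N : ∃[ N ] 1# ≤ ι N * ν × (∀ {j} → j ℕ.< N → ¬ 1# ≤ ι j * ν)
      least-N = let k , ν⁻¹≤k = archimedean (ν ⁻¹) in least (λ j → 1# ≤? ι j * ν) k (begin
        1#        ≈⟨ inverseʳ 0<ν ⟨
        ν * ν ⁻¹  ≤⟨ *-monoˡ-≤ (proj₁ 0<ν) ν⁻¹≤k ⟩
        ν * ι k   ≈⟨ *-comm ν (ι k) ⟩
        ι k * ν   ∎)

      2^n≥n : ∀ k → k ℕ.≤ 2 ℕ.^ k
      2^n≥n zero    = z≤n
      2^n≥n (suc k) = ℕₚ.≤-trans (ℕₚ.+-mono-≤ (ℕ.>-nonZero⁻¹ _ {{ℕₚ.m^n≢0 2 k}}) (2^n≥n k))
                                 (ℕₚ.≤-reflexive (≡.cong (2 ℕ.^ k ℕ.+_) (≡.sym (ℕₚ.+-identityʳ _))))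

      least-m : ∃[ m ] h ℕ.* proj₁ least-N ℕ.≤ 2 ℕ.^ m × (∀ {j} → j ℕ.< m → ¬ h ℕ.* proj₁ least-N ℕ.≤ 2 ℕ.^ j)
      least-m = least (λ j → _ ℕₚ.≤? _) (h ℕ.* proj₁ least-N) (2^n≥n _)

      least-δ : ∃[ δ ] n ℕ.≤ δ ℕ.^ h × (∀ {j} → j ℕ.< δ → ¬ n ℕ.≤ j ℕ.^ h)
      least-δ = least (λ j → _ ℕₚ.≤? _) n
        (ℕₚ.≤-trans (ℕₚ.≤-reflexive (≡.sym (ℕₚ.^-identityʳ n)))
                    (ℕₚ.^-monoʳ-≤ n {{ℕ.>-nonZero (ℕₚ.≤-trans (s≤s z≤n) 2≤n)}} 1≤h))

    N m δ e : ℕ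
    N = proj₁ least-N
    m = proj₁ least-m
    δ = proj₁ least-δ
    e = 4 ℕ.* N ℕ.* (m ℕ.+ 2)

    1≤Nν : 1# ≤ ι N * ν
    1≤Nν = proj₁ (proj₂ least-N)

    hN≤2^m : h ℕ.* N ℕ.≤ 2 ℕ.^ m
    hN≤2^m = proj₁ (proj₂ least-m)

    n≤δ^h : n ℕ.≤ δ ℕ.^ h
    n≤δ^h = proj₁ (proj₂ least-δ)

    2≤δ : 2 ℕ.≤ δ
    2≤δ = ℕₚ.≮⇒≥ λ δ<2 → ℕₚ.<⇒≱ 2≤n (ℕₚ.≤-trans n≤δ^h (ℕₚ.≤-trans
      (ℕₚ.^-monoˡ-≤ h (ℕₚ.≤-pred δ<2)) (ℕₚ.≤-reflexive (ℕₚ.^-zeroˡ h))))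

    1≤N : 1 ℕ.≤ N
    1≤N = ℕₚ.≮⇒≥ λ N<1 → 1≰0 (begin
      1#       ≤⟨ 1≤Nν ⟩
      ι N * ν  ≤⟨ *-monoʳ-≤ (proj₁ 0<ν) (ι-mono (ℕₚ.≤-pred N<1)) ⟩
      0# * ν   ≈⟨ zeroˡ ν ⟩
      0#       ∎)

    -- By minimality `(N - 1) ν ≤ 1`, and the remaining `ν` is at most 1.
    Nν≤2 : ι N * ν ≤ ι 2
    Nν≤2 = below N (proj₂ (proj₂ least-N))
      where
      below : ∀ N → (∀ {j} → j ℕ.< N → ¬ 1# ≤ ι j * ν) → ι N * ν ≤ ι 2
      below zero    _     = ≤-trans (≤-reflexive (zeroˡ ν)) (0≤ι 2)
      below (suc j) below = begin
        (1# + ι j) * ν      ≈⟨ distribʳ ν 1# (ι j) ⟩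
        1# * ν + ι j * ν    ≤⟨ +-mono-≤ (≤-trans (≤-reflexive (*-identityˡ ν)) (proj₁ ν<1)) (≰⇒≥ (below ℕₚ.≤-refl)) ⟩
        1# + 1#             ≈⟨ +-congˡ ι-1 ⟨
        ι 2                 ∎

    N-bound : ι N ≤ ι 2 * ν ⁻¹
    N-bound = *-≤⇒≤-/ 0<ν Nν≤2

    -- If `ρ ≤ δ - 1`, the `h`-th power of `δ - 1` would reach `n`, against minimality. So
    -- `δ - 1 ≤ ρ`, and `1 ≤ δ - 1` allows for the missing 1.
    δ-bound : ∀ {ρ} → RootBound n h ρ → ι δ ≤ ι 2 * ρ
    δ-bound {ρ} (0≤ρ , n≤ρ^h) = predecessor δ 2≤δ (proj₂ (proj₂ least-δ))
      where
      predecessor : ∀ δ → 2 ℕ.≤ δ → (∀ {j} → j ℕ.< δ → ¬ n ℕ.≤ j ℕ.^ h) → ι δ ≤ ι 2 * ρ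
      predecessor (suc j) (s≤s 1≤j) below = begin
        1# + ι j        ≤⟨ +-mono-≤ (≤-trans (≤-reflexive (F.sym ι-1)) (≤-trans (ι-mono 1≤j) j≤ρ)) j≤ρ ⟩
        ρ + ρ           ≈⟨ +-cong (*-identityˡ ρ) (*-identityˡ ρ) ⟨
        1# * ρ + 1# * ρ ≈⟨ distribʳ ρ 1# 1# ⟨
        (1# + 1#) * ρ   ≈⟨ *-congʳ (+-congˡ ι-1) ⟨
        ι 2 * ρ         ∎
        where
        j≤ρ : ι j ≤ ρ
        j≤ρ with total (ι j) ρ
        ... | inj₁ j≤ρ = j≤ρ
        ... | inj₂ ρ≤j = ⊥-elim (below ℕₚ.≤-refl (ι-cancel-≤ (begin
          ι n           ≤⟨ n≤ρ^h ⟩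
          ρ ^ h         ≤⟨ ^-monoˡ-≤ h 0≤ρ ρ≤j ⟩
          ι j ^ h       ≈⟨ ι-^ j h ⟨
          ι (j ℕ.^ h)   ∎)))

    -- Minimality gives `h N > 2 ^ (m - 1)`. As `N ≤ 2 / ν`, a factor 2 is lost and `h / ν` exceeds
    -- only `2 ^ (m - 2)`; hence `m - 2 ≤ ℓ`, and `1 ≤ ℓ` absorbs the 2.
    m-bound : ∀ {ℓ} → LogBound (ι h / ν) ℓ → ι m ≤ ι 3 * ℓ
    m-bound {ℓ} (1≤ℓ , bound) = by-size m (proj₂ (proj₂ least-m))
      where
      by-size : ∀ m → (∀ {j} → j ℕ.< m → ¬ h ℕ.* N ℕ.≤ 2 ℕ.^ j) → ι m ≤ ι 3 * ℓ
      by-size zero          _ = ≤-trans (ι-mono {0} {3} z≤n) (bound-const 3 1≤ℓ)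
      by-size (suc zero)    _ = ≤-trans (ι-mono {1} {3} (s≤s z≤n)) (bound-const 3 1≤ℓ)
      by-size (suc (suc j)) below = ≤-trans (≤-reflexive (ι-+ 2 j)) (bound-+ 2 1 (bound-const 2 1≤ℓ) (bound-1 j≤ℓ))
        where
        j≤ℓ : ι j ≤ ℓ
        j≤ℓ with ι j ≤? ℓ
        ... | yes j≤ℓ = j≤ℓ
        ... | no  j≰ℓ = ⊥-elim (below ℕₚ.≤-refl (ι-cancel-≤ (begin
          ι (h ℕ.* N)               ≈⟨ ι-* h N ⟩
          ι h * ι N                 ≤⟨ *-monoˡ-≤ (0≤ι h) N-bound ⟩
          ι h * (ι 2 * ν ⁻¹)        ≈⟨ x∙yz≈y∙xz (ι h) (ι 2) (ν ⁻¹) ⟩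
          ι 2 * (ι h / ν)           ≤⟨ *-monoˡ-≤ (0≤ι 2) h/ν≤2^j ⟩
          ι 2 * ι 2 ^ j             ≈⟨ ι-^ 2 (suc j) ⟨
          ι (2 ℕ.^ suc j)           ∎)))
          where
          open CommSemigroup *-commutativeSemigroup using (x∙yz≈y∙xz)
          ℓ<j : ι 1 * ℓ < ι j
          ℓ<j = ≰⇒> λ j≤ℓ → j≰ℓ (≤-trans j≤ℓ (≤-reflexive (F.trans (*-congʳ ι-1) (*-identityˡ ℓ))))
          h/ν≤2^j : ι h / ν ≤ ι 2 ^ j
          h/ν≤2^j = ≤-trans (≤-reflexive (F.sym (*-identityʳ (ι h / ν)))) (bound j 1 ℕₚ.≤-refl ℓ<j)

    1≤ν⁻¹ : 1# ≤ ν ⁻¹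
    1≤ν⁻¹ = begin
      1#          ≤⟨ *-≤⇒≤-/ 0<ν (≤-trans (≤-reflexive (*-identityˡ ν)) (proj₁ ν<1)) ⟩
      1# * ν ⁻¹   ≈⟨ *-identityˡ (ν ⁻¹) ⟩
      ν ⁻¹        ∎

    s-bound : ∀ {ℓ} → LogBound (ι h / ν) ℓ → ι (suc e) ≤ ι 41 * (ℓ / ν)
    -- 40 is 8 times 5, where 8 = 4 * 2 comes from `N ≤ 2 / ν` and 5 = 3 + 2 from `m ≤ 3 ℓ`; the 1
    -- is that of `suc e`.
    s-bound {ℓ} L@(1≤ℓ , _) = bound-+ 1 40 (≤-trans (≤-reflexive (F.sym ι-1)) (bound-const 1 1≤ℓ/ν)) (begin
      ι e                             ≈⟨ ι-* (4 ℕ.* N) (m ℕ.+ 2) ⟩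
      ι (4 ℕ.* N) * ι (m ℕ.+ 2)       ≤⟨ bound-* 8 5 (0≤ι (4 ℕ.* N)) (0≤ι (m ℕ.+ 2)) 4N-bound m+2-bound ⟩
      ι 40 * (ν ⁻¹ * ℓ)               ≈⟨ *-congˡ (*-comm (ν ⁻¹) ℓ) ⟩
      ι 40 * (ℓ / ν)                  ∎)
      where
      1≤ℓ/ν : 1# ≤ ℓ / ν
      1≤ℓ/ν = ≤-trans (≤-reflexive (F.sym (*-identityˡ 1#))) (*-mono-≤ (≤-trans 0≤1 1≤ℓ) 0≤1 1≤ℓ 1≤ν⁻¹)
      4N-bound : ι (4 ℕ.* N) ≤ ι 8 * ν ⁻¹
      4N-bound = begin
        ι (4 ℕ.* N)           ≈⟨ ι-* 4 N ⟩
        ι 4 * ι N             ≤⟨ *-monoˡ-≤ (0≤ι 4) N-bound ⟩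
        ι 4 * (ι 2 * ν ⁻¹)    ≈⟨ *-assoc (ι 4) (ι 2) (ν ⁻¹) ⟨
        ι 4 * ι 2 * ν ⁻¹      ≈⟨ *-congʳ (ι-* 4 2) ⟨
        ι 8 * ν ⁻¹            ∎
      m+2-bound : ι (m ℕ.+ 2) ≤ ι 5 * ℓ
      m+2-bound = ≤-trans (≤-reflexive (ι-+ m 2)) (bound-+ 3 2 (m-bound L) (bound-const 2 1≤ℓ))

    sδ-bound : ∀ {ρ ℓ} → RootBound n h ρ → LogBound (ι h / ν) ℓ → ι (suc e ℕ.* δ) ≤ ι 82 * (ρ * (ℓ / ν))
    sδ-bound {ρ} {ℓ} R L = begin
      ι (suc e ℕ.* δ)            ≈⟨ ι-* (suc e) δ ⟩
      ι (suc e) * ι δ            ≤⟨ bound-* 41 2 (0≤ι (suc e)) (0≤ι δ) (s-bound L) (δ-bound R) ⟩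
      ι 82 * (ℓ / ν * ρ)         ≈⟨ *-congˡ (*-comm (ℓ / ν) ρ) ⟩
      ι 82 * (ρ * (ℓ / ν))       ∎

  -- The metric of the path.

  module PathMetric {n} (P : WeightedGraph n) (isPath : IsPathGraph P) where

    module Lower = Ordered (flip _≤_) (Flip.isPreorder ≤-isPreorder) (λ p q → +-mono-≤ p q)

    Σ-nonNegative : ∀ m {f} → (∀ i → 0# ≤ f i) → 0# ≤ Σ< m f
    Σ-nonNegative m 0≤f = ≤-trans (≤-reflexive (F.sym (Σ-zero m))) (Σ-mono m λ i _ → 0≤f i)

    ι-Σ : ∀ m f → ι (ℕΣ.Σ< m f) ≈ Σ< m (ι ∘ f)
    ι-Σ zero    f = F.refl
    ι-Σ (suc m) f = F.trans (ι-+ (f 0) _) (+-congˡ (ι-Σ m (f ∘ suc)))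

    edgeWeight : Maybe Carrier → Carrier
    edgeWeight = maybe′ id 0#

    -- The index `n - 1` starts no edge and gets 0, so that sums may run over all indices below `n`.
    gap : ℕ → Carrier
    gap j with suc j ℕₚ.<? n
    ... | yes 1+j<n = edgeWeight (adj P (fromℕ< (ℕₚ.<⇒≤ 1+j<n)) (fromℕ< 1+j<n))
    ... | no  _     = 0#

    gap-adj : ∀ u v → toℕ v ≡ suc (toℕ u) → adj P u v ≡ just (gap (toℕ u))
    gap-adj u v v≡1+u with w , eq ← Equivalence.from (isPath u v) (inj₁ v≡1+u) with suc (toℕ u) ℕₚ.<? n
    ... | no  1+u≮n = ⊥-elim (1+u≮n (≡.subst (ℕ._< n) v≡1+u (Finₚ.toℕ<n v)))
    ... | yes 1+u<n = ≡.trans eq (≡.cong (just ∘ edgeWeight) (≡.sym (≡.trans (≡.cong₂ (adj P)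
          (Finₚ.fromℕ<-toℕ u _) (≡.trans (Finₚ.fromℕ<-cong _ _ (≡.sym v≡1+u) 1+u<n (Finₚ.toℕ<n v)) (Finₚ.fromℕ<-toℕ v _))) eq)))

    gap-positive : ∀ {j} → suc j ℕ.< n → 0# < gap j
    gap-positive {j} 1+j<n = ≡.subst (λ i → 0# < gap i) (Finₚ.toℕ-fromℕ< j<n)
      (positive P (fromℕ< j<n) (fromℕ< 1+j<n) (gap-adj _ _ (≡.trans (Finₚ.toℕ-fromℕ< 1+j<n)
        (≡.cong suc (≡.sym (Finₚ.toℕ-fromℕ< j<n))))))
      where j<n = ℕₚ.<⇒≤ 1+j<n

    gap-last : ∀ {j} → ¬ suc j ℕ.< n → gap j ≡ 0#
    gap-last {j} 1+j≮n with suc j ℕₚ.<? n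
    ... | yes 1+j<n = ⊥-elim (1+j≮n 1+j<n)
    ... | no  _     = ≡.refl

    0≤gap : ∀ j → 0# ≤ gap j
    0≤gap j = by-position (suc j ℕₚ.<? n)
      where
      by-position : Dec (suc j ℕ.< n) → 0# ≤ gap j
      by-position (yes 1+j<n) = proj₁ (gap-positive 1+j<n)
      by-position (no 1+j≮n)  = ≤-reflexive (reflexive (≡.sym (gap-last 1+j≮n)))

    -- The line metric as a sum of cuts, one for each edge of the path. Symmetry, triangle
    -- inequality and additivity are then checked edge by edge, and the lightness bound becomes an
    -- exchange of sums.
    dist : ℕ → ℕ → Carrier
    dist u v = Σ< n (λ e → ι (separates u v e) * gap e)

    0≤dist : ∀ u v → 0# ≤ dist u v
    0≤dist u v = Σ-nonNegative n λ e → *-nonNegative (0≤ι (separates u v e)) (0≤gap e)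

    dist-comm : ∀ u v → dist u v ≈ dist v u
    dist-comm u v = Σ-cong n λ e _ → *-congʳ (reflexive (≡.cong ι
      (ℕₚ.∣-∣-comm (𝟙 (e ℕₚ.<? u)) (𝟙 (e ℕₚ.<? v)))))

    dist-self : ∀ u → dist u u ≈ 0#
    dist-self u = F.trans (Σ-cong n λ e _ → F.trans (*-congʳ (reflexive (≡.cong ι (ℕₚ.∣n-n∣≡0 (𝟙 (e ℕₚ.<? u)))))) (zeroˡ (gap e)))
      (Σ-zero n)

    dist-split : ∀ x y z → dist x y + dist y z ≈ Σ< n (λ e → ι (separates x y e ℕ.+ separates y z e) * gap e)
    dist-split x y z = F.trans (F.sym (Σ-distrib-+ n _ _)) (Σ-cong n λ e _ →
      F.trans (F.sym (distribʳ (gap e) _ _)) (*-congʳ (F.sym (ι-+ (separates x y e) (separates y z e)))))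

    dist-triangle : ∀ x y z → dist x z ≤ dist x y + dist y z
    dist-triangle x y z = ≤-trans (Σ-mono n λ e _ → *-monoʳ-≤ (0≤gap e) (ι-mono
      (ℕₚ.∣-∣-triangle (𝟙 (e ℕₚ.<? x)) (𝟙 (e ℕₚ.<? y)) (𝟙 (e ℕₚ.<? z))))) (≤-reflexive (F.sym (dist-split x y z)))

    dist-+ : ∀ {x y z} → x ℕ.≤ y → y ℕ.≤ z → dist x y + dist y z ≈ dist x z
    dist-+ {x} {y} {z} x≤y y≤z = F.trans (dist-split x y z)
      (Σ-cong n λ e _ → *-congʳ (reflexive (≡.cong ι (separates-+ e x≤y y≤z))))

    dist-suc : ∀ {x} → x ℕ.< n → dist x (suc x) ≈ gap x
    dist-suc {x} x<n = begin-equality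
      Σ< n (λ e → ι (separates x (suc x) e) * gap e)   ≈⟨ Σ-cong n (λ e _ → at-x e) ⟩
      Σ< n (λ e → ι (𝟙 (e ℕₚ.≟ x)) * gap x)            ≈⟨ *-distribʳ-Σ n (gap x) _ ⟨
      Σ< n (λ e → ι (𝟙 (e ℕₚ.≟ x))) * gap x            ≈⟨ *-congʳ (ι-Σ n (λ e → 𝟙 (e ℕₚ.≟ x))) ⟨
      ι (ℕΣ.Σ< n (λ e → 𝟙 (e ℕₚ.≟ x))) * gap x         ≈⟨ *-congʳ (reflexive (≡.cong ι (Σ-𝟙-≡ n x<n))) ⟩
      ι 1 * gap x                                      ≈⟨ *-congʳ ι-1 ⟩
      1# * gap x                                       ≈⟨ *-identityˡ (gap x) ⟩
      gap x                                            ∎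
      where
      at-x : ∀ e → ι (separates x (suc x) e) * gap e ≈ ι (𝟙 (e ℕₚ.≟ x)) * gap x
      at-x e = F.trans (*-congʳ (reflexive (≡.cong ι (separates-suc x e)))) (same (e ℕₚ.≟ x))
        where
        same : (d : Dec (e ≡ x)) → ι (𝟙 d) * gap e ≈ ι (𝟙 d) * gap x
        same (yes e≡x) = *-congˡ (reflexive (≡.cong gap e≡x))
        same (no _)    = F.trans (zeroˡ (gap e)) (F.sym (zeroˡ (gap x)))

    dist-positive : ∀ {x y} → x ℕ.< y → y ℕ.< n → 0# < dist x y
    dist-positive {x} {y} x<y y<n = <-respʳ-≈
      (F.trans (+-congʳ (F.sym (dist-suc (ℕₚ.<-trans x<y y<n)))) (dist-+ (ℕₚ.n≤1+n x) x<y))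
      (+-positive (gap-positive (ℕₚ.≤-<-trans x<y y<n)) (0≤dist (suc x) y))

    dist-⊓⊔ : ∀ u v → dist (u ⊓ v) (u ⊔ v) ≈ dist u v
    dist-⊓⊔ u v with ℕₚ.≤-total u v
    ... | inj₁ u≤v rewrite ℕₚ.m≤n⇒m⊓n≡m u≤v | ℕₚ.m≤n⇒m⊔n≡n u≤v = F.refl
    ... | inj₂ v≤u rewrite ℕₚ.m≥n⇒m⊓n≡n v≤u | ℕₚ.m≥n⇒m⊔n≡m v≤u = dist-comm v u

    -- Shared by the path, the spanner and its induced subgraphs. It makes every walk at least as
    -- long as the distance of its ends, and increasing walks exactly as long.
    MetricWeights : WeightedGraph n → Set _
    MetricWeights G = ∀ u v {w} → adj G u v ≡ just w → w ≈ dist (toℕ u) (toℕ v)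

    dist-≤-weight : ∀ {G} → MetricWeights G → ∀ {u v} (p : Walk G u v) → dist (toℕ u) (toℕ v) ≤ weight p
    dist-≤-weight metric {u} []                       = ≤-reflexive (dist-self (toℕ u))
    dist-≤-weight metric {u} {v} (_∷_ {v = t} {w = w} e p) = begin
      dist (toℕ u) (toℕ v)                           ≤⟨ dist-triangle (toℕ u) (toℕ t) (toℕ v) ⟩
      dist (toℕ u) (toℕ t) + dist (toℕ t) (toℕ v)    ≤⟨ +-mono-≤ (≤-reflexive (F.sym (metric u t e))) (dist-≤-weight metric p) ⟩
      w + weight p                                   ∎

    module _ {G : WeightedGraph n} where

      Geodesic : Fin n → Fin n → ℕ → Set _
      Geodesic u v k = ∃ λ (p : Walk G u v) → hops p ≡ k × weight p ≈ dist (toℕ u) (toℕ v)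

      -- Along an increasing chain `dist-+` adds up without loss; this is where stretch exactly 1
      -- comes from.
      chain⇒geodesic : ∀ {_⟶_ : ℕ → ℕ → Set} → MetricWeights G → (∀ {x y} → x ⟶ y → x ℕ.< y) →
        (∀ u v → toℕ u ⟶ toℕ v → ∃[ w ] adj G u v ≡ just w) →
        ∀ {k x} u v → toℕ u ≡ x → Chain _⟶_ k x (toℕ v) → Geodesic u v k
      chain⇒geodesic metric inc edge u v u≡v [] with ≡.refl ← Finₚ.toℕ-injective u≡v =
        [] , ≡.refl , F.sym (dist-self (toℕ u))
      chain⇒geodesic {_⟶_} metric inc edge u v ≡.refl (_∷_ {y = y} e c) =
        eq ∷ p , ≡.cong suc hops≡ , F.trans (+-cong (metric u t eq) weight≈)
          (dist-+ (ℕₚ.<⇒≤ (≡.subst (toℕ u ℕ.<_) (≡.sym t≡y) (inc e))) (≡.subst (ℕ._≤ toℕ v) (≡.sym t≡y) (chain-≤ inc c)))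
        where
        t : Fin n
        t = fromℕ< (ℕₚ.≤-<-trans (chain-≤ inc c) (Finₚ.toℕ<n v))
        t≡y : toℕ t ≡ y
        t≡y = Finₚ.toℕ-fromℕ< _
        first = edge u t (≡.subst (toℕ u ⟶_) (≡.sym t≡y) e)
        eq = proj₂ first
        rest = chain⇒geodesic metric inc edge t v t≡y c
        p = proj₁ rest
        hops≡ = proj₁ (proj₂ rest)
        weight≈ = proj₂ (proj₂ rest)

      reverseOnto : ∀ {u v t} (p : Walk G u v) (q : Walk G u t) →
        ∃ λ (r : Walk G v t) → hops r ≡ hops p ℕ.+ hops q × weight r ≈ weight p + weight q
      reverseOnto []                q = q , ≡.refl , F.sym (+-identityˡ (weight q))
      reverseOnto {u} (_∷_ {v = v} {w = w} e p) q
        with r , hops≡ , weight≈ ← reverseOnto p (≡.trans (adj-sym G v u) e ∷ q) =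
        r , ≡.trans hops≡ (ℕₚ.+-suc (hops p) (hops q)) ,
        F.trans weight≈ (F.trans (x∙yz≈yx∙z (weight p) w (weight q)) F.refl)
        where open CommSemigroup +-commutativeSemigroup using (x∙yz≈yx∙z)

      reverse : ∀ {u v k} → Geodesic u v k → Geodesic v u k
      reverse {u} {v} (p , hops≡ , weight≈) with r , hops≡′ , weight≈′ ← reverseOnto p [] =
        r , ≡.trans hops≡′ (≡.trans (ℕₚ.+-identityʳ (hops p)) hops≡) ,
        F.trans weight≈′ (F.trans (+-identityʳ (weight p)) (F.trans weight≈ (dist-comm (toℕ u) (toℕ v))))

      connected : MetricWeights G → (∀ u v → toℕ v ≡ suc (toℕ u) → ∃[ w ] adj G u v ≡ just w) →
                  ∀ u v → ∃[ k ] Geodesic u v k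
      connected metric edge u v with ℕₚ.≤-total (toℕ u) (toℕ v)
      ... | inj₁ u≤v = let k , c = straight {λ x y → y ≡ suc x} (λ _ _ _ → ≡.refl) u≤v
                       in k , chain⇒geodesic metric (ℕₚ.≤-reflexive ∘ ≡.sym) edge u v ≡.refl c
      ... | inj₂ v≤u = let k , c = straight {λ x y → y ≡ suc x} (λ _ _ _ → ≡.refl) v≤u
                       in k , reverse (chain⇒geodesic metric (ℕₚ.≤-reflexive ∘ ≡.sym) edge v u ≡.refl c)

    P-metric : MetricWeights P
    P-metric u v {w} eq with Equivalence.to (isPath u v) (w , eq)
    ... | inj₁ v≡1+u = F.trans (reflexive (just-injective (≡.trans (≡.sym eq) (gap-adj u v v≡1+u))))
          (F.trans (F.sym (dist-suc (Finₚ.toℕ<n u))) (reflexive (≡.cong (dist (toℕ u)) (≡.sym v≡1+u))))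
    ... | inj₂ u≡1+v = F.trans (reflexive (just-injective (≡.trans (≡.sym eq) (≡.trans (adj-sym P u v) (gap-adj v u u≡1+v)))))
          (F.trans (F.sym (dist-suc (Finₚ.toℕ<n v)))
          (F.trans (reflexive (≡.cong (dist (toℕ v)) (≡.sym u≡1+v))) (dist-comm (toℕ v) (toℕ u))))

    -- `P` has a walk of weight `dist` and none lighter, so any shortest path metric takes this
    -- value.
    metric-unique : ∀ {d} → IsShortestPathMetric P d → ∀ u v → d u v ≈ dist (toℕ u) (toℕ v)
    metric-unique isMetric u v with isMetric u v | connected P-metric (λ u v eq → _ , gap-adj u v eq) u v
    ... | finite p weight≈d minimal | _ , q , _ , weight≈ =
      antisym (≤-trans (minimal q) (≤-reflexive weight≈)) (≤-trans (dist-≤-weight P-metric p) (≤-reflexive weight≈d))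

    -- Only the entries `(u , u + 1)` are credited with a gap; all others are nonnegative. This is
    -- the direction in which sums of gaps are compared with the weight of `P`.
    Σ-gap-≤ : Σ< n gap ≤ totalWeight P
    Σ-gap-≤ = ≤-trans (Σ-mono n gap-≤) (Lower.pairs-≲ id n _ {g} term-≤)
      where
      g : ℕ → ℕ → Carrier
      g u v = ι (𝟙 (v ℕₚ.≟ suc u)) * gap u
      gap-≤ : ∀ u → u ℕ.< n → gap u ≤ Σ< n (g u)
      gap-≤ u _ = by-position (suc u ℕₚ.<? n)
        where
        by-position : Dec (suc u ℕ.< n) → gap u ≤ Σ< n (g u)
        by-position (yes 1+u<n) = ≤-reflexive (begin-equality
          gap u                                            ≈⟨ *-identityˡ (gap u) ⟨
          1# * gap u                                       ≈⟨ *-congʳ ι-1 ⟨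
          ι 1 * gap u                                      ≈⟨ *-congʳ (reflexive (≡.cong ι (Σ-𝟙-≡ n 1+u<n))) ⟨
          ι (ℕΣ.Σ< n (λ v → 𝟙 (v ℕₚ.≟ suc u))) * gap u     ≈⟨ *-congʳ (ι-Σ n _) ⟩
          Σ< n (λ v → ι (𝟙 (v ℕₚ.≟ suc u))) * gap u        ≈⟨ *-distribʳ-Σ n (gap u) _ ⟩
          Σ< n (g u)                                       ∎)
        by-position (no 1+u≮n) = ≤-trans (≤-reflexive (reflexive (gap-last 1+u≮n)))
          (Σ-nonNegative n λ v → *-nonNegative (0≤ι (𝟙 (v ℕₚ.≟ suc u))) (0≤gap u))
      term-≤ : ∀ u v → g (toℕ u) (toℕ v) ≤ maybe′ id 0# (if does (u Finₚ.<? v) then adj P u v else nothing)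
      term-≤ u v = by-adjacency (toℕ v ℕₚ.≟ suc (toℕ u)) (u Finₚ.<? v)
        where
        by-adjacency : (d : Dec (toℕ v ≡ suc (toℕ u))) (u<v? : Dec (u Fin.< v)) →
                       ι (𝟙 d) * gap (toℕ u) ≤ maybe′ id 0# (if does u<v? then adj P u v else nothing)
        by-adjacency (yes v≡1+u) (yes _) rewrite gap-adj u v v≡1+u =
          ≤-reflexive (F.trans (*-congʳ ι-1) (*-identityˡ (gap (toℕ u))))
        by-adjacency (yes v≡1+u) (no u≮v) = ⊥-elim (u≮v (ℕₚ.≤-reflexive (≡.sym v≡1+u)))
        by-adjacency (no _) (yes _) = ≤-trans (≤-reflexive (zeroˡ (gap (toℕ u)))) (weight-nonNegative (adj P u v) ≡.refl)
          where
          weight-nonNegative : ∀ m → adj P u v ≡ m → 0# ≤ maybe′ id 0# m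
          weight-nonNegative (just w) eq = proj₁ (positive P u v eq)
          weight-nonNegative nothing  _  = ≤-refl
        by-adjacency (no _) (no _) = ≤-reflexive (zeroˡ (gap (toℕ u)))

  -- The spanner as a weighted graph.

  module PathSpanner {n} (P : WeightedGraph n) (isPath : IsPathGraph P) (h e δ : ℕ) .{{_ : ℕ.NonZero δ}} where

    open PathMetric P isPath
    open Sampling n h e δ hiding (_∈N[_]_)
    module ℕ-Ordered = ℕΣ.Ordered ℕ._≤_ ℕₚ.≤-isPreorder ℕₚ.+-mono-≤

    module _ (ts : List ℕ) where

      spannerAdj : ℕ → ℕ → Maybe Carrier
      spannerAdj x y = if does (edge? ts x y) then just (dist x y) else nothing

      spannerAdj-just : ∀ {x y w} → spannerAdj x y ≡ just w → Edge ts x y × dist x y ≡ w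
      spannerAdj-just {x} {y} = guarded-just (edge? ts x y)

      opaque
        spanner : WeightedGraph n
        spanner = record
          -- `Edge` relates increasing pairs only; passing minimum and maximum makes adjacency
          -- symmetric.
          { adj      = λ u v → spannerAdj (toℕ u ⊓ toℕ v) (toℕ u ⊔ toℕ v)
          ; adj-sym  = λ u v → ≡.cong₂ spannerAdj (ℕₚ.⊓-comm (toℕ u) (toℕ v)) (ℕₚ.⊔-comm (toℕ u) (toℕ v))
          ; loopless = λ u → ≡.trans (≡.cong₂ spannerAdj (ℕₚ.⊓-idem (toℕ u)) (ℕₚ.⊔-idem (toℕ u))) (no-loop (toℕ u))
          ; positive = λ u v eq → let (x<y , _) , dist≡w = spannerAdj-just eq
                                  in ≡.subst (0# <_) dist≡w (dist-positive x<y (ℕₚ.⊔-lub (Finₚ.toℕ<n u) (Finₚ.toℕ<n v)))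
          }
          where
          no-loop : ∀ x → spannerAdj x x ≡ nothing
          no-loop x = ≡.cong (λ b → if b then just (dist x x) else nothing)
            (dec-false (edge? ts x x) (ℕₚ.<-irrefl ≡.refl ∘ proj₁))

        spanner-metric : MetricWeights spanner
        spanner-metric u v eq = F.trans (reflexive (≡.sym (proj₂ (spannerAdj-just eq)))) (dist-⊓⊔ (toℕ u) (toℕ v))

        adj-< : ∀ u v → toℕ u ℕ.< toℕ v → adj spanner u v ≡ spannerAdj (toℕ u) (toℕ v)
        adj-< u v u<v = ≡.cong₂ spannerAdj (ℕₚ.m≤n⇒m⊓n≡m (ℕₚ.<⇒≤ u<v)) (ℕₚ.m≤n⇒m⊔n≡n (ℕₚ.<⇒≤ u<v))

      edge-adj : ∀ u v → Edge ts (toℕ u) (toℕ v) → ∃[ w ] adj spanner u v ≡ just w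
      edge-adj u v E = dist (toℕ u) (toℕ v) , ≡.trans (adj-< u v (proj₁ E))
        (≡.cong (λ b → if b then just (dist (toℕ u) (toℕ v)) else nothing) (dec-true (edge? ts (toℕ u) (toℕ v)) E))

      edge-value : ∀ {a} {A : Set a} (f : Carrier → A) z u v →
        maybe′ f z (if does (u Finₚ.<? v) then adj spanner u v else nothing) ≡
        (if does (edge? ts (toℕ u) (toℕ v)) then f (dist (toℕ u) (toℕ v)) else z)
      edge-value f z u v = by-order (u Finₚ.<? v)
        where
        by-edge : (d : Dec (Edge ts (toℕ u) (toℕ v))) →
          maybe′ f z (if does d then just (dist (toℕ u) (toℕ v)) else nothing) ≡
          (if does d then f (dist (toℕ u) (toℕ v)) else z)
        by-edge (yes _) = ≡.refl
        by-edge (no _)  = ≡.refl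
        by-order : (d : Dec (u Fin.< v)) →
          maybe′ f z (if does d then adj spanner u v else nothing) ≡
          (if does (edge? ts (toℕ u) (toℕ v)) then f (dist (toℕ u) (toℕ v)) else z)
        by-order (yes u<v) = ≡.trans (≡.cong (maybe′ f z) (adj-< u v u<v)) (by-edge (edge? ts (toℕ u) (toℕ v)))
        by-order (no u≮v)  = ≡.sym (≡.cong (λ b → if b then f (dist (toℕ u) (toℕ v)) else z)
                               (dec-false (edge? ts (toℕ u) (toℕ v)) (u≮v ∘ proj₁)))

      module _ (|ts|≡s : length ts ≡ s) where
        open EdgeCount ts |ts|≡s

        size-≤ : 2 ℕ.≤ δ → size spanner ℕ.≤ 4 ℕ.* n ℕ.* (s ℕ.* δ)
        size-≤ 2≤δ = ℕₚ.≤-trans (ℕ-Ordered.pairs-≲ (λ _ → 1) n _ {λ u v → 𝟙 (edge? ts u v)}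
          λ u v → ℕₚ.≤-reflexive (≡.trans (edge-value (λ _ → 1) 0 u v) (𝟙-does (edge? ts (toℕ u) (toℕ v)))))
          (edge-count 2≤δ)
          where
          𝟙-does : ∀ {p} {Q : Set p} (d : Dec Q) → (if does d then 1 else 0) ≡ 𝟙 d
          𝟙-does (yes _) = ≡.refl
          𝟙-does (no _)  = ≡.refl

        crossing? : ∀ u v x → Dec (Edge ts u v × u ℕ.≤ x × x ℕ.< v)
        crossing? u v x = edge? ts u v ×-dec (u ℕₚ.≤? x ×-dec x ℕₚ.<? v)

        -- The weight of each edge is spread over the gaps it spans. After exchanging the sums, no
        -- gap is counted more than `K` times.
        totalWeight-≤ : totalWeight spanner ≤ ι (h ℕ.* ((s ℕ.* δ) ℕ.* (s ℕ.* δ))) * totalWeight P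
        totalWeight-≤ = begin
          totalWeight spanner
            ≤⟨ pairs-≲ id n _ (λ u v → ≤-trans (≤-reflexive (reflexive (edge-value id 0# u v)))
                 (charge (toℕ u) (toℕ v))) ⟩
          Σ< n (λ u → Σ< n (λ v → Σ< n (λ x → ι (𝟙 (crossing? u v x)) * gap x)))
            ≈⟨ Σ-cong n (λ u _ → Σ-comm n n (λ v x → ι (𝟙 (crossing? u v x)) * gap x)) ⟩
          Σ< n (λ u → Σ< n (λ x → Σ< n (λ v → ι (𝟙 (crossing? u v x)) * gap x)))
            ≈⟨ Σ-comm n n (λ u x → Σ< n (λ v → ι (𝟙 (crossing? u v x)) * gap x)) ⟩
          Σ< n (λ x → Σ< n (λ u → Σ< n (λ v → ι (𝟙 (crossing? u v x)) * gap x)))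
            ≈⟨ Σ-cong n (λ x _ → collect x) ⟩
          Σ< n (λ x → ι (ℕΣ.Σ< n (λ u → ℕΣ.Σ< n (λ v → 𝟙 (crossing? u v x)))) * gap x)
            ≤⟨ Σ-mono n (λ x _ → *-monoʳ-≤ (0≤gap x) (ι-mono (crossing-count x))) ⟩
          Σ< n (λ x → ι K * gap x)
            ≈⟨ *-distribˡ-Σ n (ι K) gap ⟨
          ι K * Σ< n gap
            ≤⟨ *-monoˡ-≤ (0≤ι K) Σ-gap-≤ ⟩
          ι K * totalWeight P ∎
          where
          K = h ℕ.* ((s ℕ.* δ) ℕ.* (s ℕ.* δ))
          collect : ∀ x → Σ< n (λ u → Σ< n (λ v → ι (𝟙 (crossing? u v x)) * gap x)) ≈
                          ι (ℕΣ.Σ< n (λ u → ℕΣ.Σ< n (λ v → 𝟙 (crossing? u v x)))) * gap x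
          collect x = begin-equality
            Σ< n (λ u → Σ< n (λ v → ι (𝟙 (crossing? u v x)) * gap x))
              ≈⟨ Σ-cong n (λ u _ → *-distribʳ-Σ n (gap x) (λ v → ι (𝟙 (crossing? u v x)))) ⟨
            Σ< n (λ u → Σ< n (λ v → ι (𝟙 (crossing? u v x))) * gap x)
              ≈⟨ *-distribʳ-Σ n (gap x) (λ u → Σ< n (λ v → ι (𝟙 (crossing? u v x)))) ⟨
            Σ< n (λ u → Σ< n (λ v → ι (𝟙 (crossing? u v x)))) * gap x
              ≈⟨ *-congʳ (Σ-cong n λ u _ → ι-Σ n (λ v → 𝟙 (crossing? u v x))) ⟨
            Σ< n (λ u → ι (ℕΣ.Σ< n (λ v → 𝟙 (crossing? u v x)))) * gap x
              ≈⟨ *-congʳ (ι-Σ n (λ u → ℕΣ.Σ< n (λ v → 𝟙 (crossing? u v x)))) ⟨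
            ι (ℕΣ.Σ< n (λ u → ℕΣ.Σ< n (λ v → 𝟙 (crossing? u v x)))) * gap x ∎
          charge : ∀ u v → (if does (edge? ts u v) then dist u v else 0#) ≤
                           Σ< n (λ x → ι (𝟙 (crossing? u v x)) * gap x)
          charge u v = by-edge (edge? ts u v)
            where
            by-edge : (d : Dec (Edge ts u v)) → (if does d then dist u v else 0#) ≤
                      Σ< n (λ x → ι (𝟙 (d ×-dec (u ℕₚ.≤? x ×-dec x ℕₚ.<? v))) * gap x)
            by-edge (yes E) = Σ-mono n λ x _ → *-monoʳ-≤ (0≤gap x) (ι-mono (ℕₚ.≤-trans
              (separates-≤ x (proj₁ E)) (𝟙-≤ (u ℕₚ.≤? x ×-dec x ℕₚ.<? v) λ q →
                ℕₚ.≤-reflexive (≡.sym (𝟙-true (yes E ×-dec (u ℕₚ.≤? x ×-dec x ℕₚ.<? v)) (E , q))))))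
            by-edge (no _)  = Σ-nonNegative n λ x → *-nonNegative (0≤ι 0) (0≤gap x)

      induced-metric : ∀ Y → MetricWeights (induced spanner Y)
      induced-metric Y u v eq with does (u ∈? Y) ∧ does (v ∈? Y)
      ... | true = spanner-metric u v eq

      induced-adj : ∀ Y u v → u ∈ Y → v ∈ Y → adj (induced spanner Y) u v ≡ adj spanner u v
      induced-adj Y u v u∈Y v∈Y rewrite dec-true (u ∈? Y) u∈Y | dec-true (v ∈? Y) v∈Y = ≡.refl

    geodesic⇒distance : ∀ {G} → MetricWeights G → ∀ {u v k δ} → δ ≈ dist (toℕ u) (toℕ v) →
      Geodesic {G} u v k → IsDistance G u v [ δ ]
    geodesic⇒distance metric δ≈dist (p , _ , weight≈) = finite p (F.trans weight≈ (F.sym δ≈dist))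
      (λ q → ≤-trans (≤-reflexive δ≈dist) (dist-≤-weight metric q))

    -- All points are in level 0 and `2 ≤ δ ≤ block 1`, so the spanner contains the edges of `P`;
    -- this makes it connected and its distances finite.
    path-edge : 1 ℕ.≤ h → 2 ℕ.≤ δ → ∀ r x → suc x ℕ.< n → Edge (sample r) x (suc x)
    path-edge 1≤h 2≤δ r x 1+x<n = ℕₚ.≤-refl , 0 , 1≤h ,
      edgeAt (ℕₚ.≤-trans (s≤s z≤n) 1+x<n) (N₀-all x _ _) (N₀-all (suc x) _ _)
        (ℕₚ.≤-trans (ℕₚ.≤-reflexive (ℕₚ.+-comm 2 x)) (ℕₚ.+-monoʳ-≤ x
          (ℕₚ.≤-trans (ℕₚ.≤-trans 2≤δ (ℕₚ.≤-reflexive (≡.sym (ℕₚ.*-identityʳ δ)))) (δ^≤block 1))))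

    spanner-distance : 1 ℕ.≤ h → 2 ℕ.≤ δ → ∀ r u v {d} → d ≈ dist (toℕ u) (toℕ v) → IsDistance (spanner (sample r)) u v [ d ]
    spanner-distance 1≤h 2≤δ r u v d≈dist = geodesic⇒distance (spanner-metric (sample r)) d≈dist
      (proj₂ (connected (spanner-metric (sample r))
        (λ u v v≡1+u → edge-adj (sample r) u v (≡.subst (Edge (sample r) (toℕ u)) (≡.sym v≡1+u)
          (path-edge 1≤h 2≤δ r (toℕ u) (≡.subst (ℕ._< n) v≡1+u (Finₚ.toℕ<n v))))) u v))

    module _ (N : ℕ) (B : Subset n) where
      open Attack n h e δ N (member? B) (Member⇒< B)

      survivor-edge : ∀ ts u v → Step ts (toℕ u) (toℕ v) → ∃[ w ] adj (induced (spanner ts) (∁ B)) u v ≡ just w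
      survivor-edge ts u v (E , u∉B , v∉B) = let w , eq = edge-adj ts u v E in
        w , ≡.trans (induced-adj ts (∁ B) u v (x∉p⇒x∈∁p (u∉B ∘ ∈⇒Member)) (x∉p⇒x∈∁p (v∉B ∘ ∈⇒Member))) eq

      -- `chain` only runs upwards; for `y < x` its walk is reversed.
      survivor-geodesic : n ℕ.≤ δ ℕ.^ h → ∀ ts x y → ¬ Lost ts (toℕ x) → ¬ Lost ts (toℕ y) →
        ∃[ k ] k ℕ.≤ 2 ℕ.* h ℕ.+ 1 × Geodesic {induced (spanner ts) (∁ B)} x y k
      survivor-geodesic n≤δ^h ts x y keptˣ keptʸ with ℕₚ.<-cmp (toℕ x) (toℕ y)
      ... | tri< x<y _ _ = let k , k≤ , c = chain n≤δ^h keptˣ keptʸ x<y (Finₚ.toℕ<n y)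
                           in k , k≤ , chain⇒geodesic (induced-metric ts (∁ B)) (proj₁ ∘ proj₁) (survivor-edge ts) x y ≡.refl c
      ... | tri≈ _ x≡y _ = 0 , z≤n , chain⇒geodesic {_⟶_ = Step ts} (induced-metric ts (∁ B)) (proj₁ ∘ proj₁) (survivor-edge ts) x y x≡y []
      ... | tri> _ _ y<x = let k , k≤ , c = chain n≤δ^h keptʸ keptˣ y<x (Finₚ.toℕ<n x)
                           in k , k≤ , reverse (chain⇒geodesic (induced-metric ts (∁ B)) (proj₁ ∘ proj₁) (survivor-edge ts) y x ≡.refl c)

  -- The distribution, its reliability, lightness and size.

  module Theorem {n} (P : WeightedGraph n) (isPath : IsPathGraph P)
    (d : Fin n → Fin n → Carrier) (isMetric : IsShortestPathMetric P d)
    (ν : Carrier) (h N e δ : ℕ) (1≤h : 1 ℕ.≤ h) (1≤N : 1 ℕ.≤ N) (1≤Nν : 1# ≤ ι N * ν)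
    (enough : 4 ℕ.* h ℕ.* N ℕ.* (4 ℕ.* N) ℕ.^ e ℕ.≤ suc (4 ℕ.* N) ℕ.^ e)
    (2≤δ : 2 ℕ.≤ δ) (n≤δ^h : n ℕ.≤ δ ℕ.^ h) where

    open PathMetric P isPath using (Geodesic; metric-unique; 0≤gap; Σ-gap-≤; Σ-nonNegative)
    open AddSupremum _≤_ using ([_])

    instance
      δ≢0 : ℕ.NonZero δ
      δ≢0 = ℕ.>-nonZero (ℕₚ.≤-trans (s≤s z≤n) 2≤δ)

    open PathSpanner P isPath h e δ
    open Sampling n h e δ using (s; M; M≢0; sample)

    T : ℕ
    T = M ℕ.^ s

    1≤T : 1 ℕ.≤ T
    1≤T = ℕ.>-nonZero⁻¹ T {{ℕₚ.m^n≢0 M s {{M≢0}}}}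

    |sample|≡s : ∀ r → length (sample r) ≡ s
    |sample|≡s = Digits.length-digits M {{M≢0}} s

    D : Distribution n
    D = record
      { k          = T
      ; graph      = λ i → spanner (sample (toℕ i))
      ; prob       = λ _ → ι T ⁻¹
      ; prob>0     = λ _ → 0<⁻¹ (0<ι 1≤T)
      ; prob-total = sum-uniform T 1≤T
      }

    module _ (B : Subset n) where
      open Attack n h e δ N (member? B) (Member⇒< B)

      B⁺ : Fin T → Subset n
      B⁺ i = select (lost? (sample (toℕ i))) n

      B⊆B⁺ : ∀ i → B ⊆ B⁺ i
      B⊆B⁺ i x∈B = select-∈ (lost? (sample (toℕ i))) (B⊆Lost (∈⇒Member x∈B))

      short : ∀ i {x y} → x ∉ B⁺ i → y ∉ B⁺ i →
        ∃[ k ] k ℕ.≤ 2 ℕ.* h ℕ.+ 1 × Geodesic {induced (spanner (sample (toℕ i))) (∁ B)} x y k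
      short i {x} {y} x∉B⁺ y∉B⁺ = survivor-geodesic N B n≤δ^h (sample (toℕ i)) x y
        (x∉B⁺ ∘ select-∈ (lost? (sample (toℕ i)))) (y∉B⁺ ∘ select-∈ (lost? (sample (toℕ i))))

      expectation : Distribution.𝔼 D (λ i → ι ∣ B⁺ i ∣) ≤ (1# + ν) * ι ∣ B ∣
      expectation = begin
        Distribution.𝔼 D (λ i → ι ∣ B⁺ i ∣)
          ≈⟨ sum-scaled T (ι T ⁻¹) _ lost (λ i → *-congˡ (reflexive (≡.cong ι (∣select∣ (lost? (sample (toℕ i))) n)))) ⟩
        ι T ⁻¹ * ι (ℕΣ.Σ< T lost)
          ≤⟨ average-≤ T 1≤T {b = |B|} 1≤N 1≤Nν (Σ-lost enough) ⟩
        (1# + ν) * ι |B|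
          ≈⟨ *-congˡ (reflexive (≡.cong ι (∣p∣≡Σ B))) ⟨
        (1# + ν) * ι ∣ B ∣ ∎
        where
        lost : ℕ → ℕ
        lost r = ℕΣ.Σ< n (λ x → 𝟙 (lost? (sample r) x))

    reliableHopSpanner : IsObliviousReliableHopSpanner d ν (2 ℕ.* h ℕ.+ 1) 1# D
    reliableHopSpanner = record
      { dominating = λ i u v → [ d u v ] ,
          spanner-distance 1≤h 2≤δ (toℕ i) u v (metric-unique isMetric u v) , [ ≤-refl ]
      ; reliable = λ B → B⁺ B , B⊆B⁺ B , (λ i x∉B⁺ y∉B⁺ →
          let k , k≤ , geo = short B i x∉B⁺ y∉B⁺ in within B i geo k≤) , expectation B
      }
      where
      d≤1*d : ∀ x y → d x y ≤ 1# * d x y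
      d≤1*d x y = ≤-reflexive (F.sym (*-identityˡ (d x y)))
      within : ∀ B i {x y k} → Geodesic {induced (spanner (sample (toℕ i))) (∁ B)} x y k → k ℕ.≤ 2 ℕ.* h ℕ.+ 1 →
        (∃ λ δ → IsDistance (induced (spanner (sample (toℕ i))) (∁ B)) x y δ × δ ≤⁺ [ 1# * d x y ]) ×
        (∃ λ (p : Walk (induced (spanner (sample (toℕ i))) (∁ B)) x y) →
          hops p ℕ.≤ 2 ℕ.* h ℕ.+ 1 × weight p ≤ 1# * d x y)
      within B i {x} {y} geo@(p , hops≡ , weight≈) k≤ =
        ([ d x y ] , geodesic⇒distance (induced-metric (sample (toℕ i)) (∁ B)) (metric-unique isMetric x y) geo , [ d≤1*d x y ]) ,
        (p , ≡.subst (ℕ._≤ 2 ℕ.* h ℕ.+ 1) (≡.sym hops≡) k≤ ,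
         ≤-trans (≤-reflexive (F.trans weight≈ (F.sym (metric-unique isMetric x y)))) (d≤1*d x y))

    -- Squaring the bound on `s * δ` puts `κ * κ` into the lightness. The size uses the bound once,
    -- and the factor 4 of `size-≤` fits into the other `κ`, so one constant serves both.
    module _ {ρ ℓ} (κ : ℕ) (4≤κ : 4 ℕ.≤ κ) (sδ≤ : ι (s ℕ.* δ) ≤ ι κ * (ρ * (ℓ / ν))) where

      q : Carrier
      q = ℓ / ν

      hasLightness : HasLightness D (totalWeight P) (ι (κ ℕ.* κ) * (ι h * ρ ^ 2 * q ^ 2))
      hasLightness i = ≤-trans (totalWeight-≤ (sample (toℕ i)) (|sample|≡s (toℕ i)))
        (*-monoʳ-≤ 0≤totalWeight (begin
          ι (h ℕ.* (X ℕ.* X))                        ≈⟨ F.trans (ι-* h _) (*-congˡ (ι-* X X)) ⟩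
          ι h * (ι X * ι X)                          ≤⟨ *-monoˡ-≤ (0≤ι h) (bound-* κ κ (0≤ι X) (0≤ι X) sδ≤ sδ≤) ⟩
          ι h * (ι (κ ℕ.* κ) * (ρ * q * (ρ * q)))    ≈⟨ x∙yz≈y∙xz (ι h) _ _ ⟩
          ι (κ ℕ.* κ) * (ι h * (ρ * q * (ρ * q)))    ≈⟨ *-congˡ (*-congˡ (interchange ρ q ρ q)) ⟩
          ι (κ ℕ.* κ) * (ι h * (ρ * ρ * (q * q)))    ≈⟨ *-congˡ (*-assoc (ι h) (ρ * ρ) (q * q)) ⟨
          ι (κ ℕ.* κ) * (ι h * (ρ * ρ) * (q * q))    ≈⟨ *-congˡ (*-cong (*-congˡ (square ρ)) (square q)) ⟩
          ι (κ ℕ.* κ) * (ι h * ρ ^ 2 * q ^ 2)        ∎))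
        where
        open CommSemigroup *-commutativeSemigroup using (interchange; x∙yz≈y∙xz)
        X = s ℕ.* δ
        square : ∀ x → x * x ≈ x ^ 2
        square x = *-congˡ (F.sym (*-identityʳ x))
        0≤totalWeight : 0# ≤ totalWeight P
        0≤totalWeight = ≤-trans (Σ-nonNegative n 0≤gap) Σ-gap-≤

      hasSize : HasSize D (ι (κ ℕ.* κ) * (ι n * ρ * q))
      hasSize i = begin
        ι (size (spanner (sample (toℕ i))))        ≤⟨ ι-mono (size-≤ (sample (toℕ i)) (|sample|≡s (toℕ i)) 2≤δ) ⟩
        ι (4 ℕ.* n ℕ.* (s ℕ.* δ))                  ≈⟨ ι-* (4 ℕ.* n) (s ℕ.* δ) ⟩
        ι (4 ℕ.* n) * ι (s ℕ.* δ)                  ≤⟨ bound-* κ κ (0≤ι (4 ℕ.* n)) (0≤ι (s ℕ.* δ)) 4n≤κn sδ≤ ⟩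
        ι (κ ℕ.* κ) * (ι n * (ρ * q))              ≈⟨ *-congˡ (*-assoc (ι n) ρ q) ⟨
        ι (κ ℕ.* κ) * (ι n * ρ * q)                ∎
        where
        4n≤κn : ι (4 ℕ.* n) ≤ ι κ * ι n
        4n≤κn = ≤-trans (ι-mono (ℕₚ.*-monoˡ-≤ n 4≤κ)) (≤-reflexive (ι-* κ n))

theorem16 : ∀ {c ℓ₁ ℓ₂} →
    ∃[ C ] ((F : ArchimedeanOrderedField c ℓ₁ ℓ₂) →
    let open ArchimedeanOrderedField F
        open Spanners F
    in
    (ν : Carrier) → 0# < ν → ν < 1# →
    (n h : ℕ) → 1 ℕ.≤ h → h ℕ.≤ ⌊log₂ n ⌋ →
    (P : WeightedGraph n) → IsPathGraph P →
    (d : Fin n → Fin n → Carrier) → IsShortestPathMetric P d →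
    ∃[ D ] IsObliviousReliableHopSpanner d ν (2 ℕ.* h ℕ.+ 1) 1# D ×
    (∀ ρ ℓ → RootBound n h ρ → LogBound (ι h / ν) ℓ →
    HasLightness D (totalWeight P) (ι C * (ι h * ρ ^ 2 * (ℓ / ν) ^ 2)) ×
    HasSize D (ι C * (ι n * ρ * (ℓ / ν)))))
-- The constant arises from s ≤ 41 ℓ/ν and δ ≤ 2 ρ, that is s δ ≤ 82 ρ ℓ/ν.
theorem16 = 82 ℕ.* 82 , λ F ν 0<ν ν<1 n h 1≤h h≤log P isPath d isMetric →
  let open OverField F
      open Parameters ν 0<ν ν<1 n h 1≤h (2≤n 1≤h h≤log)
      open Theorem P isPath d isMetric ν h N e δ 1≤h 1≤N 1≤Nν
        (repetitions-suffice h N m {{ℕ.>-nonZero 1≤N}} hN≤2^m) 2≤δ n≤δ^h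
      4≤82 = s≤s (s≤s (s≤s (s≤s z≤n)))
  in D , reliableHopSpanner , λ ρ ℓ root log →
     hasLightness 82 4≤82 (sδ-bound root log) , hasSize 82 4≤82 (sδ-bound root log)
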